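{- For every integer $n\ge 1$, $$\sum_{T\in\mathcal{A}_n}\mathrm{wt}(T)=\prod_{i=1}^{n-1}\big(iX_i+(n+1-i)\big),$$ where $\mathcal{A}_n$ is the set of André trees on $n$ vertices and $$\mathrm{wt}(T)=\prod_{\substack{1\le i\le n\\ h_i(T)>1}}\Big(X_{i-1}\big(h_i(T)-1\big)+2\Big).$$
   Context: An André tree on $n$ vertices is a rooted labelled tree such that each internal (non-leaf) vertex has either one or two children, children being unordered, and the vertices are labelled bijectively with the integers $1,\dots,n$, decreasingly from the root to the leaves (each vertex has a larger label than its children). $\mathcal{A}_n$ denotes the set of André trees with $n$ vertices. For $1\le i\le n$, the hook length $h_i(T)$ is the number of vertices below the vertex with label $i$ in $T$, including itself (i.e. the size of the subtree rooted at it). $X_0,X_1,X_2,\dots$ are commuting indeterminates. -}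

module Defs where

open import Data.Bool.Base using (if_then_else_)
open import Data.Integer.Base as ℤ using (ℤ; 0ℤ; 1ℤ; +_)
open import Data.List.Base
  using (List; []; _∷_; [_]; _++_; map; foldr; filter; concatMap; length
        ; applyUpTo; cartesianProductWith; deduplicate)
open import Data.List.Properties using (≡-dec; length-++; length-applyUpTo)
open import Data.List.Membership.Propositional using (_∈_; lose)
open import Data.List.Membership.Propositional.Properties
  using (∈-++⁺ˡ; ∈-++⁺ʳ; ∈-map⁺; ∈-concatMap⁺; ∈-cartesianProductWith⁺; ∈-filter⁺)
open import Data.List.Relation.Binary.Permutation.Propositional
  using (_↭_; ↭-sym; ↭-trans; ↭-reflexive; ↭⇒↭ₛ)
open import Data.List.Relation.Binary.Permutation.Propositional.Properties
  using (∈-resp-↭; ↭-length)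
open import Data.List.Relation.Binary.Pointwise using (Pointwise-≡⇒≡)
open import Data.List.Relation.Unary.All using (All)
open import Data.List.Relation.Unary.All.Properties using (all-filter; deduplicate⁺)
open import Data.List.Relation.Unary.Any as Any using (Any; here; there)
import Data.List.Relation.Unary.Any.Properties as Any
open import Data.List.Relation.Unary.AllPairs using (AllPairs)
open import Data.List.Relation.Unary.Sorted.TotalOrder.Properties using (↗↭↗⇒≋)
import Data.List.Relation.Unary.Unique.DecSetoid.Properties as Unique
import Data.List.Sort.InsertionSort as InsertionSort
open import Data.Nat.Base using (ℕ; zero; suc; _+_; _∸_; _≤_; _<_; s≤s)
open import Data.Nat.Properties
  using (_≟_; _<?_; ≤-decTotalOrder; ≤-totalOrder; ≤-trans; ≤-reflexive; m≤m+n; m≤n+m)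
open import Data.Product.Base using (∃; _×_; _,_; proj₁; proj₂)
open import Data.Sum.Base using (inj₁; inj₂)
open import Data.Unit.Base using (⊤; tt)
open import Function.Base using (_∘_)
open import Level using (0ℓ)
open import Relation.Binary.Bundles using (DecSetoid)
open import Relation.Binary.Definitions using (Decidable)
open import Relation.Binary.PropositionalEquality
  using (_≡_; refl; trans; subst)
open import Relation.Nullary.Decidable
  using (Dec; yes; no; does; map′; _×-dec_; _⊎-dec_)
open import Relation.Nullary.Negation using (¬_)
open import Relation.Unary using (Pred)

infix 4 _↭?_

_↭?_ : Decidable (_↭_ {A = ℕ})
xs ↭? ys = map′ sound complete (≡-dec _≟_ (sort xs) (sort ys))
  where
  open InsertionSort ≤-decTotalOrder using (insertionSort)
  open import Data.List.Sort.Base ≤-totalOrder using (module SortingAlgorithm)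
  open SortingAlgorithm insertionSort

  sound : sort xs ≡ sort ys → xs ↭ ys
  sound eq = ↭-trans (↭-sym (sort-↭ xs)) (↭-trans (↭-reflexive eq) (sort-↭ ys))

  complete : xs ↭ ys → sort xs ≡ sort ys
  complete p = Pointwise-≡⇒≡
    (↗↭↗⇒≋ ≤-totalOrder (sort-↗ xs) (sort-↗ ys)
      (↭⇒↭ₛ (↭-trans (sort-↭ xs) (↭-trans p (↭-sym (sort-↭ ys))))))

------------------------------------------------------------------------
-- The polynomial ring ℤ[X₀, X₁, X₂, …]

-- The list i₁ ∷ … ∷ iₖ ∷ [] stands for X_{i₁} ⋯ X_{iₖ}; as the indeterminates
-- commute, two lists are the same monomial iff they are permutations.
Monomial : Set
Monomial = List ℕ

-- A formal sum of terms c · m; like terms need not be collected.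
Poly : Set
Poly = List (ℤ × Monomial)

coeff : Monomial → Poly → ℤ
coeff m p = foldr ℤ._+_ 0ℤ (map proj₁ (filter (λ t → proj₂ t ↭? m) p))

infix  4 _≈_
infixl 6 _⊕_
infixl 7 _⊗_

_≈_ : Poly → Poly → Set
p ≈ q = ∀ m → coeff m p ≡ coeff m q

_⊕_ : Poly → Poly → Poly
_⊕_ = _++_

_⊗_ : Poly → Poly → Poly
_⊗_ = cartesianProductWith λ (c , m) (d , m′) → (c ℤ.* d , m ++ m′)

const : ℕ → Poly
const c = [ (+ c , []) ]

X : ℕ → Poly
X i = [ (1ℤ , [ i ]) ]

∑ ∏ : {A : Set} → List A → (A → Poly) → Poly
∑ xs f = foldr _⊕_ (const 0) (map f xs)
∏ xs f = foldr _⊗_ (const 1) (map f xs)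

infixr 5 ∑ ∏
syntax ∑ xs (λ x → p) = ∑[ x ∈ xs ] p
syntax ∏ xs (λ x → p) = ∏[ x ∈ xs ] p

[1⋯_] : ℕ → List ℕ
[1⋯ n ] = applyUpTo suc n

------------------------------------------------------------------------
-- André trees

-- Labelled trees drawn in the plane; _≃_ below forgets the order of children.
data Tree : Set where
  leaf : ℕ → Tree
  one  : ℕ → Tree → Tree
  two  : ℕ → Tree → Tree → Tree

label : Tree → ℕ
label (leaf a)    = a
label (one a _)   = a
label (two a _ _) = a

labels : Tree → List ℕ
labels (leaf a)    = [ a ]
labels (one a t)   = a ∷ labels t
labels (two a t u) = a ∷ labels t ++ labels u

size : Tree → ℕ
size T = length (labels T)

Decreasing : Tree → Set
Decreasing (leaf a)    = ⊤
Decreasing (one a t)   = label t < a × Decreasing t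
Decreasing (two a t u) = (label t < a × Decreasing t) × (label u < a × Decreasing u)

infix 4 _≃_

data _≃_ : Tree → Tree → Set where
  leaf : ∀ {a} → leaf a ≃ leaf a
  one  : ∀ {a t t′} → t ≃ t′ → one a t ≃ one a t′
  two  : ∀ {a t t′ u u′} → t ≃ t′ → u ≃ u′ → two a t u ≃ two a t′ u′
  swap : ∀ {a t t′ u u′} → t ≃ u′ → u ≃ t′ → two a t u ≃ two a t′ u′

-- 𝒜 n, as a set, is this predicate on trees up to _≃_.
𝒜 : ℕ → Pred Tree 0ℓ
𝒜 n T = labels T ↭ [1⋯ n ] × Decreasing T

-- Size of the subtree rooted at the vertex labelled i. A tree in 𝒜 n has exactly
-- one such vertex for 1 ≤ i ≤ n, so at most one summand in the last clause is
-- non-zero.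
h : ℕ → Tree → ℕ
h i T@(leaf a)    = if does (i ≟ a) then size T else 0
h i T@(one a t)   = if does (i ≟ a) then size T else h i t
h i T@(two a t u) = if does (i ≟ a) then size T else h i t + h i u

wt : ℕ → Tree → Poly
wt n T = ∏[ i ∈ filter (λ i → 1 <? h i T) [1⋯ n ] ]
           (X (i ∸ 1) ⊗ const (h i T ∸ 1) ⊕ const 2)

-- ts contains exactly one representative of each _≃_-class of trees satisfying P.
record _Enumerates_ (ts : List Tree) (P : Pred Tree 0ℓ) : Set where
  field
    sound    : All P ts
    complete : ∀ {T} → P T → Any (T ≃_) ts
    distinct : AllPairs (λ T U → ¬ T ≃ U) ts

------------------------------------------------------------------------
-- 𝒜 n is finite, so that a sum over it makes sense: filter a list containing all
-- trees of bounded height with labels in [1⋯ n ], then discard duplicates.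

≃-refl : ∀ {t} → t ≃ t
≃-refl {leaf a}    = leaf
≃-refl {one a t}   = one ≃-refl
≃-refl {two a t u} = two ≃-refl ≃-refl

≃-sym : ∀ {t u} → t ≃ u → u ≃ t
≃-sym leaf       = leaf
≃-sym (one p)    = one (≃-sym p)
≃-sym (two p q)  = two (≃-sym p) (≃-sym q)
≃-sym (swap p q) = swap (≃-sym q) (≃-sym p)

≃-trans : ∀ {t u v} → t ≃ u → u ≃ v → t ≃ v
≃-trans leaf       leaf         = leaf
≃-trans (one p)    (one p′)     = one (≃-trans p p′)
≃-trans (two p q)  (two p′ q′)  = two (≃-trans p p′) (≃-trans q q′)
≃-trans (two p q)  (swap p′ q′) = swap (≃-trans p p′) (≃-trans q q′)
≃-trans (swap p q) (two p′ q′)  = swap (≃-trans p q′) (≃-trans q p′)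
≃-trans (swap p q) (swap p′ q′) = two (≃-trans p q′) (≃-trans q p′)

_≃?_ : Decidable _≃_
leaf a    ≃? leaf b    = map′ (λ { refl → leaf }) (λ { leaf → refl }) (a ≟ b)
leaf _    ≃? one _ _   = no λ ()
leaf _    ≃? two _ _ _ = no λ ()
one _ _   ≃? leaf _    = no λ ()
one a t   ≃? one b u   =
  map′ (λ { (refl , p) → one p }) (λ { (one p) → refl , p }) (a ≟ b ×-dec t ≃? u)
one _ _   ≃? two _ _ _ = no λ ()
two _ _ _ ≃? leaf _    = no λ ()
two _ _ _ ≃? one _ _   = no λ ()
two a t u ≃? two b v w =
  map′ (λ { (refl , inj₁ (p , q)) → two p q ; (refl , inj₂ (p , q)) → swap p q })
       (λ { (two p q) → refl , inj₁ (p , q) ; (swap p q) → refl , inj₂ (p , q) })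
       (a ≟ b ×-dec ((t ≃? v ×-dec u ≃? w) ⊎-dec (t ≃? w ×-dec u ≃? v)))

≃-decSetoid : DecSetoid 0ℓ 0ℓ
≃-decSetoid = record
  { _≈_ = _≃_
  ; isDecEquivalence = record
    { isEquivalence = record { refl = ≃-refl ; sym = ≃-sym ; trans = ≃-trans }
    ; _≟_ = _≃?_
    }
  }

decreasing? : ∀ T → Dec (Decreasing T)
decreasing? (leaf a)    = yes tt
decreasing? (one a t)   = label t <? a ×-dec decreasing? t
decreasing? (two a t u) =
  (label t <? a ×-dec decreasing? t) ×-dec (label u <? a ×-dec decreasing? u)

𝒜? : ∀ n T → Dec (𝒜 n T)
𝒜? n T = labels T ↭? [1⋯ n ] ×-dec decreasing? T

trees : ℕ → List ℕ → List Tree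
trees zero    as = []
trees (suc k) as =
  map leaf as ++
  cartesianProductWith one as (trees k as) ++
  concatMap (λ a → cartesianProductWith (two a) (trees k as) (trees k as)) as

∈-trees : ∀ k as T → size T ≤ k → (∀ {i} → i ∈ labels T → i ∈ as) → T ∈ trees k as
∈-trees (suc k) as (leaf a) _ f = ∈-++⁺ˡ (∈-map⁺ leaf (f (here refl)))
∈-trees (suc k) as (one a t) (s≤s le) f =
  ∈-++⁺ʳ (map leaf as)
    (∈-++⁺ˡ (∈-cartesianProductWith⁺ one (f (here refl)) (∈-trees k as t le (f ∘ there))))
∈-trees (suc k) as (two a t u) (s≤s le) f =
  ∈-++⁺ʳ (map leaf as) (∈-++⁺ʳ (cartesianProductWith one as (trees k as))
    (∈-concatMap⁺ _ (lose (f (here refl)) (∈-cartesianProductWith⁺ (two a)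
      (∈-trees k as t (≤-trans (m≤m+n _ _) le′) (f ∘ there ∘ ∈-++⁺ˡ))
      (∈-trees k as u (≤-trans (m≤n+m _ _) le′) (f ∘ there ∘ ∈-++⁺ʳ (labels t)))))))
  where
  le′ : size t + size u ≤ k
  le′ = subst (_≤ k) (length-++ (labels t)) le

𝒜-finite : ∀ n → ∃ λ ts → ts Enumerates 𝒜 n
𝒜-finite n = deduplicate _≃?_ candidates , record
  { sound    = deduplicate⁺ _≃?_ (all-filter (𝒜? n) (trees n [1⋯ n ]))
  ; complete = λ {T} T∈𝒜 → Any.deduplicate⁺ _≃?_ (λ p q → ≃-trans q (≃-sym p))
      (Any.map (λ { refl → ≃-refl }) (∈-filter⁺ (𝒜? n) (∈-all T T∈𝒜) T∈𝒜))
  ; distinct = Unique.deduplicate-! ≃-decSetoid candidates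
  }
  where
  candidates : List Tree
  candidates = filter (𝒜? n) (trees n [1⋯ n ])

  ∈-all : ∀ T → 𝒜 n T → T ∈ trees n [1⋯ n ]
  ∈-all T (p , _) = ∈-trees n [1⋯ n ] T
    (≤-reflexive (trans (↭-length p) (length-applyUpTo suc n))) (∈-resp-↭ p)

{-# OPTIONS --safe #-}
module Submission where

-- Removing the root of an André tree, which carries the largest label, leaves its children: an
-- unordered pair made of a tree containing the next label and a possibly empty one. So the sum
-- of the weights satisfies a recursion over the ways to split the remaining labels in two. For
-- labels s₁ < … < sₖ with indeterminates xⱼ put
--   Gₐ = a ∏_{2≤j≤k} ((j-1) xⱼ + k-j+1+a)    (and Gₐ = 1 for k = 0).
-- The claim is that the sum is G₁, and the recursion for it is the case a = b = 1 of the
-- Abel-type identity Σ Gₐ(B) G_b(C) = a/(a+b) G_{a+b}, over the splittings into B and C with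
-- the largest label in B; adding its mirror image gives Gₐ ⋆ G_b = G_{a+b} for the convolution
-- ⋆ over all splittings. The identity goes by induction on k: both sides are linear in xₖ, the
-- constant terms agree by induction, and the linear ones once the derivation "multiply by the
-- number of labels" is applied to Gₐ as the a-th convolution power of G₁.

open import Defs
open import Algebra.Bundles using (CommutativeSemiring)
import Algebra.Properties.CommutativeMonoid.Mult as CommutativeMonoidMult
import Algebra.Properties.CommutativeSemigroup as CommutativeSemigroup
import Algebra.Properties.Semiring.Mult as SemiringMult
open import Algebra.Structures.Biased using (isCommutativeSemiringˡ; isCommutativeMonoidˡ)
open import Data.Bool.Base using (true; false; if_then_else_)
open import Data.Integer.Base as ℤ using (ℤ; 0ℤ; 1ℤ; +_)
import Data.Integer.Properties as ℤ
open import Data.List.Base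
  using (List; []; _∷_; [_]; _++_; map; foldr; filter; concatMap; cartesianProductWith; length
        ; applyDownFrom)
open import Data.List.Membership.Propositional using (_∈_; _∉_; find; lose)
open import Data.List.Membership.Propositional.Properties
  using (∈-++⁺ˡ; ∈-++⁺ʳ; ∈-++⁻; ∈-map⁺; ∈-map⁻; ∈-∃++; ∈-concatMap⁻; ∈-cartesianProductWith⁻)
import Data.List.Membership.Setoid as SetoidMembership
import Data.List.Membership.Setoid.Properties as SetoidMembershipₚ
open import Data.List.Properties
  using (++-assoc; length-++; length-applyDownFrom; applyUpTo-∷ʳ; reverse-applyUpTo)
open import Data.List.Relation.Binary.Permutation.Propositional
  using (_↭_; ↭-refl; ↭-sym; ↭-trans; prep; ↭⇒↭ₛ; ↭⇒↭ₛ′)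
open import Data.List.Relation.Binary.Permutation.Propositional.Properties as ↭
  using (++⁺ˡ; ++⁺ʳ; ++⁺; ++-comm; shift; ∈-resp-↭; ↭-length; drop-∷; All-resp-↭; ↭-reverse; ¬x∷xs↭[])
import Data.List.Relation.Binary.Permutation.Setoid as SetoidPermutation
import Data.List.Relation.Binary.Permutation.Setoid.Properties as SetoidPermutationₚ
open import Data.List.Relation.Unary.All as All using (All; []; _∷_)
import Data.List.Relation.Unary.All.Properties as All
open import Data.List.Relation.Unary.AllPairs as AllPairs using (AllPairs; []; _∷_)
import Data.List.Relation.Unary.AllPairs.Properties as AllPairs
open import Data.List.Relation.Unary.Any as Any using (Any; here; there)
import Data.List.Relation.Unary.Any.Properties as Any
import Data.List.Relation.Unary.Unique.Setoid as UniqueSetoid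
open import Data.Nat.Base as ℕ using (ℕ; zero; suc; _+_; _∸_; _≤_; _<_; _>_; _≥_; z≤n; s≤s)
open import Data.Nat.Properties as ℕ
  using (_≟_; _<?_; ≤-refl; ≤-reflexive; ≤-trans; <⇒≤; m≤m+n; m≤n+m; n≤1+n; m≤n⇒m≤1+n)
open import Data.Product.Base using (_×_; _,_; proj₁; proj₂; ∃; ∃₂; map₁; map₂)
open import Data.Sum.Base using (_⊎_; inj₁; inj₂)
open import Data.Unit.Base using (tt)
open import Function.Base using (_∘_)
open import Function.Bundles using (mk⇔)
open import Level using (0ℓ)
open import Relation.Binary.Bundles using (DecSetoid; Setoid)
open import Relation.Binary.Core using (Rel)
open import Relation.Binary.PropositionalEquality as ≡
  using (_≡_; _≢_; refl; sym; trans; cong; cong₂; subst; module ≡-Reasoning)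
import Relation.Binary.Reasoning.Setoid as SetoidReasoning
open import Relation.Binary.Structures using (IsEquivalence)
open import Relation.Nullary.Decidable using (does; dec-true; dec-false; does-⇔)
open import Relation.Nullary.Negation using (¬_; contradiction)
open import Relation.Unary using (Pred; Decidable)

-- Convolution over splittings, and an identity of Abel type.

module Convolution {a c ℓ} {A : Set a} (R : CommutativeSemiring c ℓ) where

  open CommutativeSemiring R
    renaming (_≈_ to _≋_; _+_ to _⊞_; refl to ≋-refl; sym to ≋-sym; trans to ≋-trans; zero to *-zero)
  open SemiringMult semiring renaming (_×_ to _·_)
  open CommutativeMonoidMult +-commutativeMonoid using (×-distrib-+)
  module +-CS = CommutativeSemigroup +-commutativeSemigroup
  open SetoidReasoning setoid

  infix  4 _≈[_]_
  infixl 6 _∔_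
  infixl 7 _⋆_

  Fun : Set _
  Fun = List A → Carrier

  _∔_ : Fun → Fun → Fun
  (f ∔ g) S = f S ⊞ g S

  scale : ℕ → Fun → Fun
  scale n f S = n · f S

  _▹_ : A → Fun → Fun
  (x ▹ f) S = f (x ∷ S)

  -- (f ⋆ g) S is the sum of f B * g C over all ways to split S into complementary sublists
  -- B and C.
  _⋆_ : Fun → Fun → Fun
  (f ⋆ g) []      = f [] * g []
  (f ⋆ g) (x ∷ S) = ((x ▹ f) ⋆ g) S ⊞ (f ⋆ (x ▹ g)) S

  D : Fun → Fun
  D f S = length S · f S

  -- Neither part of a split of `S` is longer than `S`, so this bounded equality passes through
  -- `_⋆_` (`⋆-cong`). An induction hypothesis for short lists can therefore be used inside a
  -- convolution.
  _≈[_]_ : Fun → ℕ → Fun → Set _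
  f ≈[ n ] g = ∀ S → length S ≤ n → f S ≋ g S

  everywhere : ∀ {n f g} → (∀ S → f S ≋ g S) → f ≈[ n ] g
  everywhere e S _ = e S

  ⋆-cong : ∀ {n f f′ g g′} → f ≈[ n ] f′ → g ≈[ n ] g′ → f ⋆ g ≈[ n ] f′ ⋆ g′
  ⋆-cong e e′ []      _       = *-cong (e [] z≤n) (e′ [] z≤n)
  ⋆-cong e e′ (x ∷ S) (s≤s l) = +-cong
    (⋆-cong (λ T l → e (x ∷ T) (s≤s l)) (λ T l → e′ T (ℕ.m≤n⇒m≤1+n l)) S l)
    (⋆-cong (λ T l → e T (ℕ.m≤n⇒m≤1+n l)) (λ T l → e′ (x ∷ T) (s≤s l)) S l)

  ⋆-comm : ∀ f g S → (f ⋆ g) S ≋ (g ⋆ f) S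
  ⋆-comm f g []      = *-comm _ _
  ⋆-comm f g (x ∷ S) =
    ≋-trans (+-cong (⋆-comm (x ▹ f) g S) (⋆-comm f (x ▹ g) S)) (+-comm _ _)

  ⋆-distribʳ : ∀ f g h S → ((f ∔ g) ⋆ h) S ≋ (f ⋆ h) S ⊞ (g ⋆ h) S
  ⋆-distribʳ f g h []      = distribʳ _ _ _
  ⋆-distribʳ f g h (x ∷ S) = ≋-trans
    (+-cong (⋆-distribʳ (x ▹ f) (x ▹ g) h S) (⋆-distribʳ f g (x ▹ h) S))
    (+-CS.interchange _ _ _ _)

  ⋆-distribˡ : ∀ f g h S → (f ⋆ (g ∔ h)) S ≋ (f ⋆ g) S ⊞ (f ⋆ h) S
  ⋆-distribˡ f g h S = begin
    (f ⋆ (g ∔ h)) S       ≈⟨ ⋆-comm f (g ∔ h) S ⟩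
    ((g ∔ h) ⋆ f) S       ≈⟨ ⋆-distribʳ g h f S ⟩
    (g ⋆ f) S ⊞ (h ⋆ f) S ≈⟨ +-cong (⋆-comm g f S) (⋆-comm h f S) ⟩
    (f ⋆ g) S ⊞ (f ⋆ h) S ∎

  ⋆-*ˡ : ∀ r f g S → ((λ T → r * f T) ⋆ g) S ≋ r * (f ⋆ g) S
  ⋆-*ˡ r f g []      = *-assoc _ _ _
  ⋆-*ˡ r f g (x ∷ S) =
    ≋-trans (+-cong (⋆-*ˡ r (x ▹ f) g S) (⋆-*ˡ r f (x ▹ g) S)) (≋-sym (distribˡ _ _ _))

  ⋆-scaleˡ : ∀ n f g S → (scale n f ⋆ g) S ≋ n · (f ⋆ g) S
  ⋆-scaleˡ n f g []      = ×-assoc-* n _ _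
  ⋆-scaleˡ n f g (x ∷ S) =
    ≋-trans (+-cong (⋆-scaleˡ n (x ▹ f) g S) (⋆-scaleˡ n f (x ▹ g) S)) (≋-sym (×-distrib-+ _ _ n))

  ⋆-scaleʳ : ∀ n f g S → (f ⋆ scale n g) S ≋ n · (f ⋆ g) S
  ⋆-scaleʳ n f g S = ≋-trans (⋆-comm f _ S)
    (≋-trans (⋆-scaleˡ n g f S) (×-congʳ n (⋆-comm g f S)))

  ⋆-assoc : ∀ f g h S → ((f ⋆ g) ⋆ h) S ≋ (f ⋆ (g ⋆ h)) S
  ⋆-assoc f g h []      = *-assoc _ _ _
  ⋆-assoc f g h (x ∷ S) = begin
    ((x ▹ (f ⋆ g)) ⋆ h) S ⊞ ((f ⋆ g) ⋆ (x ▹ h)) S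
      ≈⟨ +-congʳ (⋆-distribʳ ((x ▹ f) ⋆ g) (f ⋆ (x ▹ g)) h S) ⟩
    (((x ▹ f) ⋆ g) ⋆ h) S ⊞ ((f ⋆ (x ▹ g)) ⋆ h) S ⊞ ((f ⋆ g) ⋆ (x ▹ h)) S
      ≈⟨ +-cong (+-cong (⋆-assoc _ g h S) (⋆-assoc f _ h S)) (⋆-assoc f g _ S) ⟩
    ((x ▹ f) ⋆ (g ⋆ h)) S ⊞ (f ⋆ ((x ▹ g) ⋆ h)) S ⊞ (f ⋆ (g ⋆ (x ▹ h))) S
      ≈⟨ +-assoc _ _ _ ⟩
    ((x ▹ f) ⋆ (g ⋆ h)) S ⊞ ((f ⋆ ((x ▹ g) ⋆ h)) S ⊞ (f ⋆ (g ⋆ (x ▹ h))) S)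
      ≈⟨ +-congˡ (⋆-distribˡ f _ _ S) ⟨
    ((x ▹ f) ⋆ (g ⋆ h)) S ⊞ (f ⋆ (x ▹ (g ⋆ h))) S ∎

  D-cong : ∀ {n f g} → f ≈[ n ] g → D f ≈[ n ] D g
  D-cong e S l = ×-congʳ (length S) (e S l)

  -- The lengths of the two parts of a split add up to the length of the list.
  ⋆-leibniz : ∀ f g S → D (f ⋆ g) S ≋ (D f ⋆ g) S ⊞ (f ⋆ D g) S
  ⋆-leibniz f g []      = ≋-sym (≋-trans (+-cong (zeroˡ _) (zeroʳ _)) (+-identityˡ _))
  ⋆-leibniz f g (x ∷ S) = begin
    suc n · (p ⊞ q)                   ≈⟨ +-congˡ (×-distrib-+ p q n) ⟩
    p ⊞ q ⊞ (n · p ⊞ n · q)           ≈⟨ +-CS.interchange p q _ _ ⟩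
    p ⊞ n · p ⊞ (q ⊞ n · q)
      ≈⟨ +-cong (+-congˡ (⋆-leibniz (x ▹ f) g S)) (+-congˡ (⋆-leibniz f (x ▹ g) S)) ⟩
    p ⊞ (p₁ ⊞ p₂) ⊞ (q ⊞ (q₁ ⊞ q₂))   ≈⟨ +-cong (≋-sym (+-assoc p p₁ p₂)) (+-CS.x∙yz≈y∙xz q q₁ q₂) ⟩
    p ⊞ p₁ ⊞ p₂ ⊞ (q₁ ⊞ (q ⊞ q₂))     ≈⟨ +-CS.interchange _ _ _ _ ⟩
    p ⊞ p₁ ⊞ q₁ ⊞ (p₂ ⊞ (q ⊞ q₂))
      ≈⟨ +-cong (+-congʳ (⋆-distribʳ (x ▹ f) (D (x ▹ f)) g S))
                (+-congˡ (⋆-distribˡ f (x ▹ g) (D (x ▹ g)) S)) ⟨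
    ((x ▹ D f) ⋆ g) S ⊞ q₁ ⊞ (p₂ ⊞ (f ⋆ (x ▹ D g)) S) ∎
    where
    n = length S
    p  = ((x ▹ f) ⋆ g) S
    q  = (f ⋆ (x ▹ g)) S
    p₁ = (D (x ▹ f) ⋆ g) S
    p₂ = ((x ▹ f) ⋆ D g) S
    q₁ = (D f ⋆ (x ▹ g)) S
    q₂ = (f ⋆ D (x ▹ g)) S

  -- The identity `G a ⋆ G b = G (a + b)` is the analogue for lists of a polynomial sequence of
  -- binomial type. Cancellation of positive integers stands in for a division in
  -- `additive⇒differentiated`.
  module BinomialType
    (w : A → Carrier)
    (·-cancelˡ : ∀ n {x y} → suc n · x ≋ suc n · y → x ≋ y)
    where

    -- J n (x ∷ S) is the polynomial in n given by G n (x ∷ S) / n.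
    G J : ℕ → Fun
    G n []      = 1#
    G n (x ∷ S) = n · J n (x ∷ S)
    J n []      = 0#
    J n (x ∷ S) = G (suc n) S ⊞ w x * (length S · J (suc n) S)

    -- `G n` and `n · J n` differ only at `[]`, and there `D` vanishes.
    D-G : ∀ n S → D (G n) S ≋ n · D (J n) S
    D-G n []      = ≋-sym (·-zeroʳ n)
      where
      ·-zeroʳ : ∀ n → n · 0# ≋ 0#
      ·-zeroʳ zero    = ≋-refl
      ·-zeroʳ (suc n) = ≋-trans (+-identityˡ _) (·-zeroʳ n)
    D-G n (x ∷ S) = begin
      k · (n · J n (x ∷ S))   ≈⟨ ×-assocˡ _ k n ⟩
      (k ℕ.* n) · J n (x ∷ S) ≈⟨ ×-congˡ (ℕ.*-comm k n) ⟩
      (n ℕ.* k) · J n (x ∷ S) ≈⟨ ×-assocˡ _ n k ⟨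
      n · (k · J n (x ∷ S))   ∎
      where k = suc (length S)

    -- The three statements form one induction on length: `Additive n` yields `Differentiated n`,
    -- both yield `Rooted n`, and since `Rooted n` speaks of lists with one more element `x`, it
    -- yields `Additive (suc n)`.
    Additive Differentiated Rooted : ℕ → Set _
    Additive       n = ∀ a b → G a ⋆ G b ≈[ n ] G (a ℕ.+ b)
    Differentiated n = ∀ a → D (J (suc a)) ≈[ n ] D (J 1) ⋆ G a
    Rooted         n = ∀ x a b → (x ▹ J a) ⋆ G b ≈[ n ] x ▹ J (a ℕ.+ b)

    J-step : ∀ x a b S → ((x ▹ J a) ⋆ G b) S
      ≋ (G (suc a) ⋆ G b) S ⊞ w x * (D (J (suc a)) ⋆ G b) S
    J-step x a b S = ≋-trans
      (⋆-distribʳ (G (suc a)) (λ T → w x * D (J (suc a)) T) (G b) S)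
      (+-congˡ (⋆-*ˡ (w x) _ _ S))

    -- `G 0` is 1 at `[]` and a zero multiple on nonempty lists, hence the unit of `_⋆_`.
    ⋆-G0 : ∀ f S → (f ⋆ G 0) S ≋ f S
    ⋆-G0 f []      = *-identityʳ _
    ⋆-G0 f (x ∷ S) = ≋-trans
      (+-cong (⋆-G0 (x ▹ f) S) (⋆-scaleʳ 0 f (x ▹ J 0) S)) (+-identityʳ _)

    -- This is the power rule for the derivation `D`: by additivity `G (suc a)` is the convolution
    -- power of `G 1` with exponent `suc a`, so `D (G (suc a))` is `suc a` times `D (G 1) ⋆ G a`.
    -- Writing `D (G n)` as `n · D (J n)` and cancelling `suc a` gives the claim.
    additive⇒differentiated : ∀ n → Additive n → Differentiated n
    additive⇒differentiated n add zero    S l = ≋-sym (⋆-G0 (D (J 1)) S)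
    additive⇒differentiated n add (suc a) S l = ·-cancelˡ (suc a) (begin
      suc (suc a) · D (J (suc (suc a))) S
        ≈⟨ D-G (suc (suc a)) S ⟨
      D (G (suc (suc a))) S
        ≈⟨ D-cong (add 1 (suc a)) S l ⟨
      D (G 1 ⋆ G (suc a)) S
        ≈⟨ ⋆-leibniz (G 1) (G (suc a)) S ⟩
      (D (G 1) ⋆ G (suc a)) S ⊞ (G 1 ⋆ D (G (suc a))) S
        ≈⟨ +-cong
            (⋆-cong {n} (everywhere λ T → ≋-trans (D-G 1 T) (+-identityʳ _))
                    (everywhere λ _ → ≋-refl) S l)
            (≋-trans (⋆-cong {n} (everywhere λ _ → ≋-refl) (everywhere (D-G (suc a))) S l)
                   (⋆-scaleʳ (suc a) (G 1) (D (J (suc a))) S)) ⟩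
      (D (J 1) ⋆ G (suc a)) S ⊞ suc a · (G 1 ⋆ D (J (suc a))) S
        ≈⟨ +-congˡ (×-congʳ (suc a) (begin
            (G 1 ⋆ D (J (suc a))) S     ≈⟨ ⋆-cong (everywhere λ _ → ≋-refl)
                                             (additive⇒differentiated n add a) S l ⟩
            (G 1 ⋆ (D (J 1) ⋆ G a)) S   ≈⟨ ⋆-comm (G 1) _ S ⟩
            (D (J 1) ⋆ G a ⋆ G 1) S     ≈⟨ ⋆-assoc (D (J 1)) (G a) (G 1) S ⟩
            (D (J 1) ⋆ (G a ⋆ G 1)) S   ≈⟨ ⋆-cong {n} (everywhere λ _ → ≋-refl) (add a 1) S l ⟩
            (D (J 1) ⋆ G (a ℕ.+ 1)) S
              ≡⟨ cong (λ k → (D (J 1) ⋆ G k) S) (ℕ.+-comm a 1) ⟩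
            (D (J 1) ⋆ G (suc a)) S     ∎)) ⟩
      suc (suc a) · (D (J 1) ⋆ G (suc a)) S ∎)

    -- `J-step` separates the part free of `w x` from the multiple of `w x`. Additivity settles the
    -- former; in the latter both sides reduce to `D (J 1) ⋆ G (a + b)`.
    additive⇒rooted : ∀ n → Additive n → Rooted n
    additive⇒rooted n add x a b S l = ≋-trans (J-step x a b S)
      (+-cong (add (suc a) b S l) (*-congˡ (begin
        (D (J (suc a)) ⋆ G b) S      ≈⟨ ⋆-cong (diff a) (everywhere λ _ → ≋-refl) S l ⟩
        (D (J 1) ⋆ G a ⋆ G b) S      ≈⟨ ⋆-assoc (D (J 1)) (G a) (G b) S ⟩
        (D (J 1) ⋆ (G a ⋆ G b)) S    ≈⟨ ⋆-cong {n} (everywhere λ _ → ≋-refl) (add a b) S l ⟩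
        (D (J 1) ⋆ G (a ℕ.+ b)) S    ≈⟨ diff (a ℕ.+ b) S l ⟨
        D (J (suc (a ℕ.+ b))) S      ∎)))
      where diff = additive⇒differentiated n add

    -- The head falls into the left or the right part of a split. By `rooted` the two cases give `a`
    -- and `b` copies of the same value `J (a + b)`.
    additive : ∀ n → Additive n
    additive n       a b []      l = *-identityˡ 1#
    additive (suc n) a b (x ∷ S) (s≤s l) = begin
      (scale a (x ▹ J a) ⋆ G b) S ⊞ (G a ⋆ scale b (x ▹ J b)) S
        ≈⟨ +-cong (⋆-scaleˡ a _ _ S) (⋆-scaleʳ b _ _ S) ⟩
      a · ((x ▹ J a) ⋆ G b) S ⊞ b · (G a ⋆ (x ▹ J b)) S
        ≈⟨ +-cong (×-congʳ a (rooted x a b S l))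
             (×-congʳ b (≋-trans (⋆-comm (G a) _ S) (rooted x b a S l))) ⟩
      a · J (a ℕ.+ b) (x ∷ S) ⊞ b · J (b ℕ.+ a) (x ∷ S)
        ≡⟨ cong (λ k → a · J (a ℕ.+ b) (x ∷ S) ⊞ b · J k (x ∷ S)) (ℕ.+-comm b a) ⟩
      a · J (a ℕ.+ b) (x ∷ S) ⊞ b · J (a ℕ.+ b) (x ∷ S)
        ≈⟨ ×-homo-+ (J (a ℕ.+ b) (x ∷ S)) a b ⟨
      (a ℕ.+ b) · J (a ℕ.+ b) (x ∷ S) ∎
      where rooted = additive⇒rooted n (additive n)

    rooted : ∀ x a b S → ((x ▹ J a) ⋆ G b) S ≋ J (a ℕ.+ b) (x ∷ S)
    rooted x a b S = additive⇒rooted (length S) (additive _) x a b S ℕ.≤-refl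

    -- On the nonempty list `y ∷ S` the term `G (suc n)` is itself a multiple of `J (suc n)`, so the
    -- recursion for `J` factors. Iterated, it produces the closed product.
    J-∷∷ : ∀ x y S n → J n (x ∷ y ∷ S)
      ≋ (suc (length S) · w x ⊞ suc n · 1#) * J (suc n) (y ∷ S)
    J-∷∷ x y S n = begin
      suc n · j ⊞ w x * (k · j)         ≈⟨ +-comm _ _ ⟩
      w x * (k · j) ⊞ suc n · j
        ≈⟨ +-cong (×-comm-* k (w x) j) (×-congʳ (suc n) (≋-sym (*-identityˡ j))) ⟩
      k · (w x * j) ⊞ suc n · (1# * j)
        ≈⟨ +-cong (×-assoc-* k (w x) j) (×-assoc-* (suc n) 1# j) ⟨
      (k · w x) * j ⊞ (suc n · 1#) * j  ≈⟨ distribʳ _ _ _ ⟨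
      (k · w x ⊞ suc n · 1#) * j ∎
      where
      k = suc (length S)
      j = J (suc n) (y ∷ S)

-- Polynomials as a commutative semiring without torsion.

open CommutativeSemigroup ℤ.+-commutativeSemigroup using (interchange)
open CommutativeSemigroup ℤ.*-commutativeSemigroup using (x∙yz≈y∙xz)

Symmetric : (Monomial → ℤ) → Set
Symmetric f = ∀ {m m′} → m ↭ m′ → f m ≡ f m′

pair : Poly → (Monomial → ℤ) → ℤ
pair []            f = 0ℤ
pair ((c , m) ∷ p) f = c ℤ.* f m ℤ.+ pair p f

module _ where
  open ≡-Reasoning

  pair-cong : ∀ p {f g} → (∀ m → f m ≡ g m) → pair p f ≡ pair p g
  pair-cong []            f≗g = refl
  pair-cong ((c , m) ∷ p) f≗g = cong₂ ℤ._+_ (cong (c ℤ.*_) (f≗g m)) (pair-cong p f≗g)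

  pair-⊕ : ∀ p q f → pair (p ⊕ q) f ≡ pair p f ℤ.+ pair q f
  pair-⊕ []            q f = sym (ℤ.+-identityˡ _)
  pair-⊕ ((c , m) ∷ p) q f =
    trans (cong (λ x → c ℤ.* f m ℤ.+ x) (pair-⊕ p q f)) (sym (ℤ.+-assoc (c ℤ.* f m) _ _))

  pair-+ : ∀ p f g → pair p (λ m → f m ℤ.+ g m) ≡ pair p f ℤ.+ pair p g
  pair-+ []            f g = refl
  pair-+ ((c , m) ∷ p) f g = trans
    (cong₂ ℤ._+_ (ℤ.*-distribˡ-+ c (f m) (g m)) (pair-+ p f g))
    (interchange (c ℤ.* f m) (c ℤ.* g m) (pair p f) (pair p g))

  pair-* : ∀ p d f → pair p (λ m → d ℤ.* f m) ≡ d ℤ.* pair p f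
  pair-* []            d f = sym (ℤ.*-zeroʳ d)
  pair-* ((c , m) ∷ p) d f = trans
    (cong₂ ℤ._+_ (x∙yz≈y∙xz c d (f m)) (pair-* p d f))
    (sym (ℤ.*-distribˡ-+ d _ _))

  pair-0 : ∀ p → pair p (λ _ → 0ℤ) ≡ 0ℤ
  pair-0 []            = refl
  pair-0 ((c , _) ∷ p) = cong₂ ℤ._+_ (ℤ.*-zeroʳ c) (pair-0 p)

  pair-map : ∀ c m q f →
    pair (map (λ (d , m′) → c ℤ.* d , m ++ m′) q) f ≡ c ℤ.* pair q (λ m′ → f (m ++ m′))
  pair-map c m []             f = sym (ℤ.*-zeroʳ c)
  pair-map c m ((d , m′) ∷ q) f = trans
    (cong₂ ℤ._+_ (ℤ.*-assoc c d _) (pair-map c m q f))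
    (sym (ℤ.*-distribˡ-+ c _ _))

  pair-⊗ : ∀ p q f → pair (p ⊗ q) f ≡ pair p (λ m → pair q (λ m′ → f (m ++ m′)))
  pair-⊗ []            q f = refl
  pair-⊗ ((c , m) ∷ p) q f = trans
    (pair-⊕ (map _ q) (p ⊗ q) f)
    (cong₂ ℤ._+_ (pair-map c m q f) (pair-⊗ p q f))

  pair-swap : ∀ p q (F : Monomial → Monomial → ℤ) →
    pair p (λ m → pair q (F m)) ≡ pair q (λ m′ → pair p (λ m → F m m′))
  pair-swap []            q F = sym (pair-0 q)
  pair-swap ((c , m) ∷ p) q F = begin
    c ℤ.* pair q (F m) ℤ.+ pair p (λ k → pair q (F k))
      ≡⟨ cong₂ ℤ._+_ (sym (pair-* q c (F m))) (pair-swap p q F) ⟩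
    pair q (λ m′ → c ℤ.* F m m′) ℤ.+ pair q (λ m′ → pair p (λ k → F k m′))
      ≡⟨ sym (pair-+ q _ _) ⟩
    pair q (λ m′ → c ℤ.* F m m′ ℤ.+ pair p (λ k → F k m′)) ∎

infix 4 _∼_

-- Testing against all symmetric functions makes ⊗ an iterated pairing, so that the semiring
-- laws become Fubini-type statements; testing against indicators recovers the coefficients.
record _∼_ (p q : Poly) : Set where
  constructor tested
  field test : ∀ f → Symmetric f → pair p f ≡ pair q f

open _∼_

∼⇒≈ : ∀ {p q} → p ∼ q → p ≈ q
∼⇒≈ {p} {q} p∼q m = trans (coeff-pair p) (trans (test p∼q δ δ-sym) (sym (coeff-pair q)))
  where
  δ : Monomial → ℤ
  δ m′ = if does (m′ ↭? m) then 1ℤ else 0ℤ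

  δ-sym : Symmetric δ
  δ-sym {m₁} {m₂} s = cong (if_then 1ℤ else 0ℤ)
    (does-⇔ (mk⇔ (↭-trans (↭-sym s)) (↭-trans s)) (m₁ ↭? m) (m₂ ↭? m))

  coeff-pair : ∀ p → coeff m p ≡ pair p δ
  coeff-pair []             = refl
  coeff-pair ((c , m′) ∷ p) with does (m′ ↭? m)
  ... | true  = cong₂ ℤ._+_ (sym (ℤ.*-identityʳ c)) (coeff-pair p)
  ... | false = trans (coeff-pair p)
    (sym (trans (cong (ℤ._+ pair p δ) (ℤ.*-zeroʳ c)) (ℤ.+-identityˡ _)))

⊗-pair-cong : ∀ {p p′ q q′} → p ∼ p′ → q ∼ q′ → p ⊗ q ∼ p′ ⊗ q′
⊗-pair-cong {p} {p′} {q} {q′} e e′ = tested λ f s → begin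
  pair (p ⊗ q) f                             ≡⟨ pair-⊗ p q f ⟩
  pair p (λ m → pair q (λ m′ → f (m ++ m′)))
    ≡⟨ pair-cong p (λ m → test e′ _ (λ r → s (++⁺ˡ m r))) ⟩
  pair p (λ m → pair q′ (λ m′ → f (m ++ m′)))
    ≡⟨ test e _ (λ r → pair-cong q′ (λ m′ → s (++⁺ʳ m′ r))) ⟩
  pair p′ (λ m → pair q′ (λ m′ → f (m ++ m′))) ≡⟨ sym (pair-⊗ p′ q′ f) ⟩
  pair (p′ ⊗ q′) f ∎
  where open ≡-Reasoning

⊗-comm : ∀ p q → p ⊗ q ∼ q ⊗ p
⊗-comm p q = tested λ f s → begin
  pair (p ⊗ q) f                              ≡⟨ pair-⊗ p q f ⟩
  pair p (λ m → pair q (λ m′ → f (m ++ m′)))  ≡⟨ pair-swap p q _ ⟩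
  pair q (λ m′ → pair p (λ m → f (m ++ m′)))
    ≡⟨ pair-cong q (λ m′ → pair-cong p (λ m → s (++-comm m m′))) ⟩
  pair q (λ m′ → pair p (λ m → f (m′ ++ m)))  ≡⟨ sym (pair-⊗ q p f) ⟩
  pair (q ⊗ p) f ∎
  where open ≡-Reasoning

⊗-assoc : ∀ p q r → p ⊗ q ⊗ r ∼ p ⊗ (q ⊗ r)
⊗-assoc p q r = tested λ f s → begin
  pair (p ⊗ q ⊗ r) f                            ≡⟨ pair-⊗ (p ⊗ q) r f ⟩
  pair (p ⊗ q) (λ m → pair r (λ k → f (m ++ k))) ≡⟨ pair-⊗ p q _ ⟩
  pair p (λ m → pair q (λ m′ → pair r (λ k → f ((m ++ m′) ++ k))))
    ≡⟨ pair-cong p (λ m → pair-cong q (λ m′ → pair-cong r (λ k → cong f (++-assoc m m′ k)))) ⟩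
  pair p (λ m → pair q (λ m′ → pair r (λ k → f (m ++ m′ ++ k))))
    ≡⟨ pair-cong p (λ m → sym (pair-⊗ q r _)) ⟩
  pair p (λ m → pair (q ⊗ r) (λ k → f (m ++ k))) ≡⟨ sym (pair-⊗ p (q ⊗ r) f) ⟩
  pair (p ⊗ (q ⊗ r)) f ∎
  where open ≡-Reasoning

⊗-identityˡ : ∀ p → const 1 ⊗ p ∼ p
⊗-identityˡ p = tested λ f _ →
  trans (pair-⊗ (const 1) p f) (trans (ℤ.+-identityʳ _) (ℤ.*-identityˡ _))

⊗-distribʳ : ∀ p q r → (q ⊕ r) ⊗ p ∼ q ⊗ p ⊕ r ⊗ p
⊗-distribʳ p q r = tested λ f _ → begin
  pair ((q ⊕ r) ⊗ p) f  ≡⟨ pair-⊗ (q ⊕ r) p f ⟩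
  pair (q ⊕ r) _        ≡⟨ pair-⊕ q r _ ⟩
  pair q _ ℤ.+ pair r _ ≡⟨ sym (cong₂ ℤ._+_ (pair-⊗ q p f) (pair-⊗ r p f)) ⟩
  pair (q ⊗ p) f ℤ.+ pair (r ⊗ p) f ≡⟨ sym (pair-⊕ (q ⊗ p) (r ⊗ p) f) ⟩
  pair (q ⊗ p ⊕ r ⊗ p) f ∎
  where open ≡-Reasoning

pair-const : ∀ n p f → pair (const n ⊗ p) f ≡ + n ℤ.* pair p f
pair-const n p f = trans (pair-⊗ (const n) p f) (ℤ.+-identityʳ _)

∼-isEquivalence : IsEquivalence _∼_
∼-isEquivalence = record
  { refl  = tested λ _ _ → refl
  ; sym   = λ e → tested λ f s → sym (test e f s)
  ; trans = λ e e′ → tested λ f s → trans (test e f s) (test e′ f s)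
  }

polySemiring : CommutativeSemiring 0ℓ 0ℓ
polySemiring = record
  { Carrier = Poly ; _≈_ = _∼_ ; _+_ = _⊕_ ; _*_ = _⊗_ ; 0# = const 0 ; 1# = const 1
  ; isCommutativeSemiring = isCommutativeSemiringˡ record
    { +-isCommutativeMonoid = isCommutativeMonoidˡ record
      { isSemigroup = record
        { isMagma = record
          { isEquivalence = ∼-isEquivalence
          ; ∙-cong = λ {p} {p′} {q} {q′} e e′ → tested λ f s →
              trans (pair-⊕ p q f) (trans (cong₂ ℤ._+_ (test e f s) (test e′ f s))
                (sym (pair-⊕ p′ q′ f)))
          }
        ; assoc = λ p q r → tested λ f _ → cong (λ x → pair x f) (++-assoc p q r)
        }
      -- `const 0` is the term 0 · 1 and not the empty sum; its pairing `0ℤ * f []` computes to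
      -- `0ℤ`.
      ; identityˡ = λ p → tested λ f _ → ℤ.+-identityˡ (pair p f)
      ; comm = λ p q → tested λ f _ →
          trans (pair-⊕ p q f) (trans (ℤ.+-comm (pair p f) _) (sym (pair-⊕ q p f)))
      }
    ; *-isCommutativeMonoid = isCommutativeMonoidˡ record
      { isSemigroup = record
        { isMagma = record
          { isEquivalence = ∼-isEquivalence
          ; ∙-cong = ⊗-pair-cong
          }
        ; assoc = ⊗-assoc
        }
      ; identityˡ = ⊗-identityˡ
      ; comm = ⊗-comm
      }
    ; distribʳ = ⊗-distribʳ
    ; zeroˡ = λ p → tested λ f _ → pair-const 0 p f
    }
  }

open CommutativeSemiring polySemiring
  using ( +-cong; +-congˡ; +-congʳ; +-assoc; +-identityˡ; +-identityʳ; +-isCommutativeMonoid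
        ; *-cong; *-congˡ; *-congʳ; *-assoc; *-identityˡ; *-identityʳ; *-isCommutativeMonoid
        ; distribˡ; distribʳ; zeroˡ; zeroʳ; setoid; reflexive; semiring)
  renaming (refl to ∼-refl; sym to ∼-sym; trans to ∼-trans)
open SemiringMult semiring using () renaming (_×_ to _·_; ×-cong to ·-cong)

pair-· : ∀ n p f → pair (n · p) f ≡ + n ℤ.* pair p f
pair-· zero    p f = refl
pair-· (suc n) p f = trans (pair-⊕ p (n · p) f)
  (trans (cong (λ x → pair p f ℤ.+ x) (pair-· n p f)) (sym (ℤ.suc-* (+ n) (pair p f))))

const-⊗ : ∀ n p → const n ⊗ p ∼ n · p
const-⊗ n p = tested λ f _ → trans (pair-const n p f) (sym (pair-· n p f))

-- Every pairing turns `n ·` into multiplication by an integer, which cancels in ℤ when nonzero.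
·-cancelˡ : ∀ n {p q} → suc n · p ∼ suc n · q → p ∼ q
·-cancelˡ n {p} {q} e = tested λ f s → ℤ.*-cancelˡ-≡ (+ suc n) _ _
  (trans (sym (pair-· (suc n) p f)) (trans (test e f s) (pair-· (suc n) q f)))

-- Splittings of a list, and lists without repetition.

module _ {a} {A : Set a} where

  -- These are the pairs over which `_⋆_` sums. Each part keeps the order of `S`, so the parts of a
  -- descending list are descending.
  splits : List A → List (List A × List A)
  splits []      = [ [] , [] ]
  splits (x ∷ S) = map (map₁ (x ∷_)) (splits S) ++ map (map₂ (x ∷_)) (splits S)

  splits-↭ : ∀ S {B C} → (B , C) ∈ splits S → B ++ C ↭ S
  splits-↭ [] (here refl) = ↭-refl
  splits-↭ (x ∷ S) i with ∈-++⁻ (map (map₁ (x ∷_)) (splits S)) i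
  ... | inj₁ j with _ , k , refl ← ∈-map⁻ (map₁ (x ∷_)) j = prep x (splits-↭ S k)
  ... | inj₂ j with (B , C) , k , refl ← ∈-map⁻ (map₂ (x ∷_)) j =
    ↭-trans (shift x B C) (prep x (splits-↭ S k))

  splits-AllPairs : ∀ {r} {R : Rel A r} S → AllPairs R S → ∀ {B C} → (B , C) ∈ splits S →
    AllPairs R B × AllPairs R C
  splits-AllPairs [] _ (here refl) = [] , []
  splits-AllPairs (x ∷ S) (Rx ∷ RS) i with ∈-++⁻ (map (map₁ (x ∷_)) (splits S)) i
  ... | inj₁ j with (B , C) , k , refl ← ∈-map⁻ (map₁ (x ∷_)) j =
    map₁ (All.++⁻ˡ B (All-resp-↭ (↭-sym (splits-↭ S k)) Rx) ∷_) (splits-AllPairs S RS k)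
  ... | inj₂ j with (B , C) , k , refl ← ∈-map⁻ (map₂ (x ∷_)) j =
    map₂ (All.++⁻ʳ B (All-resp-↭ (↭-sym (splits-↭ S k)) Rx) ∷_) (splits-AllPairs S RS k)

  splits-[] : ∀ S → (S , []) ∈ splits S
  splits-[] []      = here refl
  splits-[] (x ∷ S) = ∈-++⁺ˡ (∈-map⁺ (map₁ (x ∷_)) (splits-[] S))

  ∈⇒↭∷ : ∀ {x : A} {xs} → x ∈ xs → ∃ λ ys → xs ↭ x ∷ ys
  ∈⇒↭∷ {x} i with ys , zs , refl ← ∈-∃++ i = ys ++ zs , shift x ys zs

  -- The head of `S` occurs in `xs` or in `ys`; it is removed there and the rest is split
  -- recursively.
  splits-complete : ∀ S xs ys → xs ++ ys ↭ S →
    ∃₂ λ B C → (B , C) ∈ splits S × xs ↭ B × ys ↭ C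
  splits-complete [] []       []       _ = [] , [] , here refl , ↭-refl , ↭-refl
  splits-complete [] []       (_ ∷ _)  p = contradiction p ¬x∷xs↭[]
  splits-complete [] (_ ∷ _)  _        p = contradiction p ¬x∷xs↭[]
  splits-complete (x ∷ S) xs ys p with ∈-++⁻ xs (∈-resp-↭ (↭-sym p) (here refl))
  ... | inj₁ i with zs , e ← ∈⇒↭∷ i
      with B , C , j , q , r ← splits-complete S zs ys
             (drop-∷ (↭-trans (++⁺ʳ ys (↭-sym e)) p)) =
    x ∷ B , C , ∈-++⁺ˡ (∈-map⁺ (map₁ (x ∷_)) j) , ↭-trans e (prep x q) , r
  ... | inj₂ i with zs , e ← ∈⇒↭∷ i
      with B , C , j , q , r ← splits-complete S xs zs
             (drop-∷ (↭-trans (↭-sym (shift x xs zs)) (↭-trans (++⁺ˡ xs (↭-sym e)) p))) =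
    B , x ∷ C , ∈-++⁺ʳ (map (map₁ (x ∷_)) (splits S)) (∈-map⁺ (map₂ (x ∷_)) j) ,
    q , ↭-trans e (prep x r)

  -- Without repetitions in `S`, the first part alone identifies the split, even up to order. This
  -- is the form needed because a tree reveals the labels of a child only as a permuted list.
  splits-distinct : ∀ S → AllPairs _≢_ S →
    AllPairs (λ p q → ¬ (proj₁ p ↭ proj₁ q)) (splits S)
  splits-distinct [] _ = [] ∷ []
  splits-distinct (x ∷ S) (x∉S ∷ S!) = AllPairs.++⁺
    (AllPairs.map⁺ (AllPairs.map (λ ≠ → ≠ ∘ drop-∷) (splits-distinct S S!)))
    (AllPairs.map⁺ (splits-distinct S S!))
    (All.tabulate λ i → All.tabulate λ j → cross i j)
    where
    cross : ∀ {p q} → p ∈ map (map₁ (x ∷_)) (splits S) → q ∈ map (map₂ (x ∷_)) (splits S) →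
      ¬ (proj₁ p ↭ proj₁ q)
    cross i j e
      with _ , _ , refl ← ∈-map⁻ (map₁ (x ∷_)) i | _ , k , refl ← ∈-map⁻ (map₂ (x ∷_)) j =
      All.lookup x∉S (∈-resp-↭ (splits-↭ S k) (∈-++⁺ˡ (∈-resp-↭ e (here refl)))) refl

module _ {s ℓ} (S : Setoid s ℓ) where
  open Setoid S using () renaming (sym to ≈ₛ-sym; trans to ≈ₛ-trans)
  open SetoidMembership S using () renaming (_∈_ to _∈ₛ_)
  open SetoidPermutation S using () renaming
    (_↭_ to _↭ₛ_; ↭-sym to ↭ₛ-sym; ↭-trans to ↭ₛ-trans; ↭-prep to ↭ₛ-prep; ↭-refl to ↭ₛ-refl
    ; ↭-reflexive-≋ to ↭ₛ-reflexive)
  open SetoidPermutationₚ S using (Unique-resp-↭) renaming (shift to shiftₛ; ∈-resp-↭ to ∈ₛ-resp-↭)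
  open UniqueSetoid S using (Unique)

  -- The head of `xs` is located in `ys` and removed; uniqueness ensures that the remainders again
  -- have the same elements.
  unique∧sameElements⇒↭ : ∀ {xs ys} → Unique xs → Unique ys →
    (∀ {z} → z ∈ₛ xs → z ∈ₛ ys) → (∀ {z} → z ∈ₛ ys → z ∈ₛ xs) → xs ↭ₛ ys
  unique∧sameElements⇒↭ {[]} {[]}    _ _ _ _ = ↭ₛ-refl
  unique∧sameElements⇒↭ {[]} {_ ∷ _} _ _ _ g with () ← g (here (Setoid.refl S))
  unique∧sameElements⇒↭ {x ∷ xs} {ys} (x∉xs ∷ xs!) ys! f g
    with us , vs , w , x≈w , eq ← SetoidMembershipₚ.∈-∃++ S (f (here (Setoid.refl S)))
    = go (↭ₛ-trans (↭ₛ-reflexive eq) (shiftₛ (≈ₛ-sym x≈w) us vs))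
    where
    go : ∀ {zs} → ys ↭ₛ x ∷ zs → x ∷ xs ↭ₛ ys
    go {zs} p with x∉zs ∷ zs! ← Unique-resp-↭ p ys! =
      ↭ₛ-trans (↭ₛ-prep x (unique∧sameElements⇒↭ xs! zs! f′ g′)) (↭ₛ-sym p)
      where
      f′ : ∀ {z} → z ∈ₛ xs → z ∈ₛ zs
      f′ z∈xs with ∈ₛ-resp-↭ p (f (there z∈xs))
      ... | there z∈zs = z∈zs
      ... | here z≈x   = contradiction z∈xs
        (All.All¬⇒¬Any (All.map (λ ≠ z≈y → ≠ (≈ₛ-trans (≈ₛ-sym z≈x) z≈y)) x∉xs))
      g′ : ∀ {z} → z ∈ₛ zs → z ∈ₛ xs
      g′ z∈zs with g (∈ₛ-resp-↭ (↭ₛ-sym p) (there z∈zs))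
      ... | there z∈xs = z∈xs
      ... | here z≈x   = contradiction z∈zs
        (All.All¬⇒¬Any (All.map (λ ≠ z≈y → ≠ (≈ₛ-trans (≈ₛ-sym z≈x) z≈y)) x∉zs))

-- Generating one André tree from each class.

-- The case distinction is on the labels of the second part: no tree has an empty label list, so a
-- product with its trees would lose the roots with one child.
attach : ℕ → List Tree → List ℕ → List Tree → List Tree
attach x ts []      us = map (one x) ts
attach x ts (_ ∷ _) us = cartesianProductWith (two x) ts us

-- The second largest label is put into the first subtree, so that each unordered pair of
-- children occurs once; an empty second part of a split stands for a single child. The first
-- argument is fuel for the recursion.
build : ℕ → List ℕ → List Tree
grafts : ℕ → ℕ → ℕ → List ℕ × List ℕ → List Tree

build k       []          = []
build k       (x ∷ [])    = [ leaf x ]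
build zero    (x ∷ y ∷ S) = []
build (suc k) (x ∷ y ∷ S) = concatMap (grafts k x y) (splits S)

grafts k x y (B , C) = attach x (build k (y ∷ B)) C (build k C)

data Attached (x : ℕ) (ts us : List Tree) : List ℕ → Tree → Set where
  one : ∀ {t} → t ∈ ts → Attached x ts us [] (one x t)
  two : ∀ {t u z C} → t ∈ ts → u ∈ us → Attached x ts us (z ∷ C) (two x t u)

∈-attach⁻ : ∀ {x} ts C us {T} → T ∈ attach x ts C us → Attached x ts us C T
∈-attach⁻ ts []      us i with _ , j , refl ← ∈-map⁻ (one _) i = one j
∈-attach⁻ ts (_ ∷ _) us i
  with _ , _ , j , k , refl ← ∈-cartesianProductWith⁻ (two _) ts us i = two j k

∈-build⁻ : ∀ k {x y S T} → T ∈ build (suc k) (x ∷ y ∷ S) →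
  ∃₂ λ B C → (B , C) ∈ splits S × Attached x (build k (y ∷ B)) (build k C) C T
∈-build⁻ k {x} {y} {S} i
  with (B , C) , j , l ← find (∈-concatMap⁻ (grafts k x y) {xs = splits S} i) =
  B , C , j , ∈-attach⁻ (build k (y ∷ B)) C (build k C) l

build-labels : ∀ k S {T} → T ∈ build k S → labels T ↭ S
build-labels k       (x ∷ []) (here refl) = ↭-refl
build-labels (suc k) (x ∷ y ∷ S) i with ∈-build⁻ k {x} {y} {S} i
... | B , _ , j , one t∈ = prep x (↭-trans (build-labels k _ t∈)
  (prep y (↭-trans (↭-sym (++-comm B [])) (splits-↭ S j))))
... | B , z ∷ C , j , two t∈ u∈ = prep x (↭-trans
  (++⁺ (build-labels k (y ∷ B) t∈) (build-labels k (z ∷ C) u∈)) (prep y (splits-↭ S j)))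

label-∈ : ∀ T → label T ∈ labels T
label-∈ (leaf _)    = here refl
label-∈ (one _ _)   = here refl
label-∈ (two _ _ _) = here refl

Descending : List ℕ → Set
Descending = AllPairs _>_

build-decreasing : ∀ k S {T} → Descending S → T ∈ build k S → Decreasing T
build-decreasing k       (x ∷ []) _ (here refl) = tt
build-decreasing (suc k) (x ∷ y ∷ S) (>x ∷ >y ∷ S↘) i with ∈-build⁻ k {x} {y} {S} i
... | B , C , j , a = go a
  where
  B++C = splits-↭ S j
  B↘ : Descending (y ∷ B)
  B↘ = All.++⁻ˡ B (All-resp-↭ (↭-sym B++C) >y) ∷ proj₁ (splits-AllPairs S S↘ j)
  C↘ : Descending C
  C↘ = proj₂ (splits-AllPairs S S↘ j)
  below : All (x >_) (y ∷ B ++ C)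
  below = All-resp-↭ (↭-sym (prep y B++C)) >x
  child : ∀ {t D} → t ∈ build k D → All (x >_) D → label t < x
  child {t} {D} t∈ x>D = All.lookup x>D (∈-resp-↭ (build-labels k D t∈) (label-∈ t))
  go : ∀ {T} → Attached x (build k (y ∷ B)) (build k C) C T → Decreasing T
  go (one t∈) = child t∈ (All.++⁻ˡ (y ∷ B) below) , build-decreasing k _ B↘ t∈
  go (two t∈ u∈) =
    (child t∈ (All.++⁻ˡ (y ∷ B) below) , build-decreasing k _ B↘ t∈) ,
    (child u∈ (All.++⁻ʳ (y ∷ B) below) , build-decreasing k _ C↘ u∈)

≃-labels : ∀ {T U} → T ≃ U → labels T ↭ labels U
≃-labels leaf       = ↭-refl
≃-labels (one p)    = prep _ (≃-labels p)
≃-labels (two p q)  = prep _ (++⁺ (≃-labels p) (≃-labels q))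
≃-labels (swap {t′ = t′} p q) = prep _
  (↭-trans (++⁺ (≃-labels p) (≃-labels q)) (++-comm _ (labels t′)))

-- The invariant that separates trees coming from different splits: the child holding `y` is
-- recognisable in either order of the children, and its other labels are `B`.
data Branch (y : ℕ) (B : List ℕ) : Tree → Set where
  one : ∀ {x t} → labels t ↭ y ∷ B → Branch y B (one x t)
  two : ∀ {x t u} → labels t ↭ y ∷ B → y ∉ labels u → Branch y B (two x t u)

-- Only the first child contains `y`, so an equivalence cannot exchange the children, and the first
-- children have the same labels.
branch-≃ : ∀ {y B B′ T U} → Branch y B T → Branch y B′ U → T ≃ U → B ↭ B′
branch-≃ (one p)   (one q)   (one e)    = drop-∷ (↭-trans (↭-sym p) (↭-trans (≃-labels e) q))
branch-≃ (two p _) (two q _) (two e _)  = drop-∷ (↭-trans (↭-sym p) (↭-trans (≃-labels e) q))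
branch-≃ (two p _) (two _ n) (swap e _) =
  contradiction (∈-resp-↭ (≃-labels e) (∈-resp-↭ (↭-sym p) (here refl))) n

Distinct : List Tree → Set
Distinct = AllPairs (λ T U → ¬ T ≃ U)

-- The label `y` marks the first child, so `swap` would carry it into a tree of `us`; two equivalent
-- products thus agree child by child.
distinct-two : ∀ x y {ts us} → Distinct ts → Distinct us →
  All (λ t → y ∈ labels t) ts → All (λ u → y ∉ labels u) us →
  Distinct (cartesianProductWith (two x) ts us)
distinct-two x y [] us! [] y∉us = []
distinct-two x y {t ∷ ts} {us} (t≄ts ∷ ts!) us! (y∈t ∷ y∈ts) y∉us = AllPairs.++⁺
  (AllPairs.map⁺ (strengthen us! y∉us))
  (distinct-two x y ts! us! y∈ts y∉us)
  (All.map⁺ (All.tabulate λ {u} u∈ → All.tabulate λ i → cross u∈ i))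
  where
  strengthen : ∀ {us} → Distinct us → All (λ u → y ∉ labels u) us →
    AllPairs (λ u u′ → ¬ two x t u ≃ two x t u′) us
  strengthen [] [] = []
  strengthen (≄ ∷ us!) (_ ∷ y∉us) = All.zipWith
    (λ { (u≄ , y∉) (two _ e) → u≄ e
       ; (u≄ , y∉) (swap e _) → y∉ (∈-resp-↭ (≃-labels e) y∈t) }) (≄ , y∉us)
    ∷ strengthen us! y∉us
  cross : ∀ {u U} → u ∈ us → U ∈ cartesianProductWith (two x) ts us → ¬ two x t u ≃ U
  cross u∈ i e with ∈-cartesianProductWith⁻ (two x) ts us i
  cross u∈ i (two e _)  | _ , _ , t′∈ , u′∈ , refl = All.lookup t≄ts t′∈ e
  cross u∈ i (swap e _) | _ , _ , t′∈ , u′∈ , refl =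
    All.lookup y∉us u′∈ (∈-resp-↭ (≃-labels e) y∈t)

AllPairs-zip-All : ∀ {A : Set} {P : A → Set} {R : A → A → Set} {xs} → All P xs → AllPairs R xs →
  AllPairs (λ a b → P a × P b × R a b) xs
AllPairs-zip-All []       []       = []
AllPairs-zip-All (p ∷ ps) (r ∷ rs) =
  All.zipWith (λ (q , r) → p , q , r) (ps , r) ∷ AllPairs-zip-All ps rs

Descending⇒≢ : ∀ {S} → Descending S → AllPairs _≢_ S
Descending⇒≢ = AllPairs.map λ x>y x≡y → ℕ.<-irrefl (sym x≡y) x>y

-- Within one split the children are distinct by induction. Across splits, `branch-≃` would make the
-- first parts permutations of each other, against `splits-distinct`.
build-distinct : ∀ k S → Descending S → Distinct (build k S)
build-distinct k       []          _ = []
build-distinct k       (x ∷ [])    _ = [] ∷ []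
build-distinct zero    (x ∷ y ∷ S) _ = []
build-distinct (suc k) (x ∷ y ∷ S) (_ ∷ >y ∷ S↘) = AllPairs.concat⁺
  (All.map⁺ (All.tabulate λ {(B , C)} j → within B C j))
  (AllPairs.map⁺ (AllPairs.map
    (λ (b , b′ , ≁) → All.map (λ β → All.map (λ β′ → ≁ ∘ branch-≃ β β′) b′) b)
    (AllPairs-zip-All {P = λ p → All (Branch y (proj₁ p)) (grafts k x y p)}
      (All.tabulate λ {(B , C)} j → All.tabulate λ i → branch j (∈-attach⁻ _ C _ i))
      (splits-distinct S (Descending⇒≢ S↘)))))
  where
  y∉ : ∀ {B C} → (B , C) ∈ splits S → ∀ {u} → u ∈ build k C → y ∉ labels u
  y∉ {B} j u∈ y∈u = ℕ.<-irrefl refl (All.lookup >y (∈-resp-↭ (splits-↭ S j)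
    (∈-++⁺ʳ B (∈-resp-↭ (build-labels k _ u∈) y∈u))))
  y∈ : ∀ B {t} → t ∈ build k (y ∷ B) → y ∈ labels t
  y∈ B t∈ = ∈-resp-↭ (↭-sym (build-labels k (y ∷ B) t∈)) (here refl)
  branch : ∀ {B C T} → (B , C) ∈ splits S → Attached x (build k (y ∷ B)) (build k C) C T →
    Branch y B T
  branch j (one t∈)    = one (build-labels k (y ∷ _) t∈)
  branch j (two t∈ u∈) = two (build-labels k (y ∷ _) t∈) (y∉ j u∈)
  within : ∀ B C → (B , C) ∈ splits S → Distinct (grafts k x y (B , C))
  within B C j with splits-AllPairs S S↘ j
  within B [] j | B↘ , _ = AllPairs.map⁺ (AllPairs.map (λ { ≄ (one e) → ≄ e })
    (build-distinct k (y ∷ B) (B>y ∷ B↘)))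
    where B>y = All.++⁻ˡ B (All-resp-↭ (↭-sym (splits-↭ S j)) >y)
  within B C@(_ ∷ _) j | B↘ , C↘ = distinct-two x y
    (build-distinct k (y ∷ B) (B>y ∷ B↘)) (build-distinct k C C↘)
    (All.tabulate (y∈ B)) (All.tabulate (y∉ j))
    where B>y = All.++⁻ˡ B (All-resp-↭ (↭-sym (splits-↭ S j)) >y)

labels-≤ : ∀ T → Decreasing T → All (_≤ label T) (labels T)
labels-≤ (leaf a)    _ = ≤-refl ∷ []
labels-≤ (one a t)   (l , d) =
  ≤-refl ∷ All.map (λ m → ≤-trans m (<⇒≤ l)) (labels-≤ t d)
labels-≤ (two a t u) ((l , d) , (l′ , d′)) = ≤-refl ∷ All.++⁺
  (All.map (λ m → ≤-trans m (<⇒≤ l)) (labels-≤ t d))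
  (All.map (λ m → ≤-trans m (<⇒≤ l′)) (labels-≤ u d′))

root-label : ∀ {T x S} → Descending (x ∷ S) → labels T ↭ x ∷ S → Decreasing T → label T ≡ x
root-label {T} {x} (>x ∷ _) p d = ℕ.≤-antisym
  (All.lookup {P = _≤ x} (≤-refl ∷ All.map <⇒≤ >x) (∈-resp-↭ p (label-∈ T)))
  (All.lookup (labels-≤ T d) (∈-resp-↭ (↭-sym p) (here refl)))

labels≢[] : ∀ T → ¬ (labels T ↭ [])
labels≢[] (leaf _)    = ¬x∷xs↭[]
labels≢[] (one _ _)   = ¬x∷xs↭[]
labels≢[] (two _ _ _) = ¬x∷xs↭[]

Any-grafts : ∀ k x y S {B C} {P : Pred Tree 0ℓ} → (B , C) ∈ splits S →
  Any P (grafts k x y (B , C)) → Any P (build (suc k) (x ∷ y ∷ S))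
Any-grafts k x y S j i = Any.concatMap⁺ (grafts k x y) (lose j i)

-- The root must carry the largest label, and its children determine a split of the rest. Fuel one
-- less than the number of labels suffices, since a single label consumes none.
build-complete : ∀ k S {T} → Descending S → length S ≤ suc k →
  labels T ↭ S → Decreasing T → Any (T ≃_) (build k S)
build-complete k [] {T} _ _ p _ = contradiction p (labels≢[] T)
build-complete k (x ∷ S) {T} S↘ l p d with root-label {T} S↘ p d
build-complete k (x ∷ []) {leaf x} S↘ l p d | refl = here leaf
build-complete k (x ∷ []) {one x t} S↘ l p d | refl = contradiction (drop-∷ p) (labels≢[] t)
build-complete k (x ∷ []) {two x t u} S↘ l p d | refl =
  contradiction (∈-resp-↭ (drop-∷ p) (∈-++⁺ˡ (label-∈ t))) λ ()
build-complete zero (x ∷ y ∷ S) S↘ (s≤s ()) p d | refl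
build-complete (suc k) (x ∷ y ∷ S) {leaf x} S↘ l p d | refl =
  contradiction (↭-sym (drop-∷ p)) ¬x∷xs↭[]
build-complete (suc k) (x ∷ y ∷ S) {one x t} (_ ∷ S↘) (s≤s l) p (_ , d) | refl =
  Any-grafts k x y S (splits-[] S) (Any.map⁺ (Any.map one
    (build-complete k (y ∷ S) S↘ l (drop-∷ p) d)))
build-complete (suc k) (x ∷ y ∷ S) {two x t u} (_ ∷ >y ∷ S↘) (s≤s (s≤s l)) p
  ((_ , d) , (_ , d′)) | refl =
  place (∈-++⁻ (labels t) (∈-resp-↭ (↭-sym (drop-∷ p)) (here refl)))
  where
  -- The case in which the second largest label `y` lies in the first child; `zs` is what else that
  -- child carries.
  plant : ∀ t u {zs} → labels t ↭ y ∷ zs → labels t ++ labels u ↭ y ∷ S →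
    Decreasing t → Decreasing u → Any (two x t u ≃_) (build (suc k) (x ∷ y ∷ S))
  plant t u {zs} e p d d′
    with splits-complete S zs (labels u) (drop-∷ (↭-trans (++⁺ʳ (labels u) (↭-sym e)) p))
  ... | B , []        , j , q , r = contradiction r (labels≢[] u)
  ... | B , C@(_ ∷ _) , j , q , r = Any-grafts k x y S j (Any.cartesianProductWith⁺ (two x) two
    (build-complete k (y ∷ B) (B>y ∷ B↘) (s≤s (≤-trans (m≤m+n _ (length C)) l′))
      (↭-trans e (prep y q)) d)
    (build-complete k C C↘ (m≤n⇒m≤1+n (≤-trans (m≤n+m _ (length B)) l′)) r d′))
    where
    B>y = All.++⁻ˡ B (All-resp-↭ (↭-sym (splits-↭ S j)) >y)
    B↘ = proj₁ (splits-AllPairs S S↘ j)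
    C↘ = proj₂ (splits-AllPairs S S↘ j)
    l′ : length B + length C ≤ k
    l′ = subst (_≤ k) (trans (sym (↭-length (splits-↭ S j))) (length-++ B)) l
  place : y ∈ labels t ⊎ y ∈ labels u → Any (two x t u ≃_) (build (suc k) (x ∷ y ∷ S))
  place (inj₁ i) = plant t u (proj₂ (∈⇒↭∷ i)) (drop-∷ p) d d′
  -- Otherwise the children are exchanged first, which stays in the same class.
  place (inj₂ i) = Any.map (≃-trans (swap ≃-refl ≃-refl))
    (plant u t (proj₂ (∈⇒↭∷ i)) (↭-trans (++-comm (labels u) _) (drop-∷ p)) d′ d)

-- Finite sums and products of polynomials.

open Convolution {A = ℕ} polySemiring using (_⋆_; _▹_; Fun; module BinomialType)
-- The indeterminate follows the label and not its rank, so `G` and `J` apply to the label list of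
-- any subtree.
open BinomialType (λ i → X (i ∸ 1)) ·-cancelˡ using (G; J; rooted; J-∷∷)
open SetoidReasoning setoid

++⁻ : ∀ {A : Set} {R : A → A → Set} xs {ys} → AllPairs R (xs ++ ys) →
  AllPairs R xs × AllPairs R ys × (∀ {x y} → x ∈ xs → y ∈ ys → R x y)
++⁻ []       Rys = [] , Rys , λ ()
++⁻ (x ∷ xs) (Rx ∷ Rs) with Rxs , Rys , Rxy ← ++⁻ xs Rs =
  All.++⁻ˡ xs Rx ∷ Rxs , Rys , λ
    { (here refl) j → All.lookup (All.++⁻ʳ xs Rx) j
    ; (there i)   j → Rxy i j }

private variable
  A B C : Set

⊗-congˡ : ∀ p {q q′} → q ∼ q′ → p ⊗ q ∼ p ⊗ q′
⊗-congˡ p = *-cong (∼-refl {p})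

⊗-congʳ : ∀ q {p p′} → p ∼ p′ → p ⊗ q ∼ p′ ⊗ q
⊗-congʳ q e = *-cong e (∼-refl {q})

∑-↭ : ∀ {xs ys : List Poly} → SetoidPermutation._↭_ setoid xs ys →
  foldr _⊕_ (const 0) xs ∼ foldr _⊕_ (const 0) ys
∑-↭ = SetoidPermutationₚ.foldr-commMonoid setoid +-isCommutativeMonoid

∏-↭ : ∀ {xs ys : List A} (f : A → Poly) → xs ↭ ys → ∏ xs f ∼ ∏ ys f
∏-↭ f p = SetoidPermutationₚ.foldr-commMonoid setoid *-isCommutativeMonoid
  (↭⇒↭ₛ′ ∼-isEquivalence (↭.map⁺ f p))

∑-cong : ∀ (xs : List A) {f g : A → Poly} → (∀ {x} → x ∈ xs → f x ∼ g x) → ∑ xs f ∼ ∑ xs g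
∑-cong []       f∼g = ∼-refl
∑-cong (x ∷ xs) f∼g = +-cong (f∼g (here refl)) (∑-cong xs (f∼g ∘ there))

∏-cong : ∀ (xs : List A) {f g : A → Poly} → (∀ {x} → x ∈ xs → f x ∼ g x) → ∏ xs f ∼ ∏ xs g
∏-cong []       f∼g = ∼-refl
∏-cong (x ∷ xs) f∼g = *-cong (f∼g (here refl)) (∏-cong xs (f∼g ∘ there))

∑-++ : ∀ (xs ys : List A) f → ∑ (xs ++ ys) f ∼ ∑ xs f ⊕ ∑ ys f
∑-++ []       ys f = ∼-sym (+-identityˡ _)
∑-++ (x ∷ xs) ys f = ∼-trans (+-congˡ (∑-++ xs ys f)) (∼-sym (+-assoc (f x) _ _))

∏-++ : ∀ (xs ys : List A) f → ∏ (xs ++ ys) f ∼ ∏ xs f ⊗ ∏ ys f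
∏-++ []       ys f = ∼-sym (*-identityˡ _)
∏-++ (x ∷ xs) ys f =
  ∼-trans (⊗-congˡ (f x) (∏-++ xs ys f)) (∼-sym (*-assoc (f x) (∏ xs f) (∏ ys f)))

∏-filter : ∀ {P : Pred A 0ℓ} (P? : Decidable P) xs f →
  ∏ (filter P? xs) f ∼ ∏ xs (λ x → if does (P? x) then f x else const 1)
∏-filter P? []       f = ∼-refl
∏-filter P? (x ∷ xs) f with does (P? x)
... | true  = ⊗-congˡ (f x) (∏-filter P? xs f)
... | false = ∼-trans (∏-filter P? xs f) (∼-sym (*-identityˡ _))

⊗-distribˡ-∑ : ∀ p (xs : List A) f → ∑ xs (λ x → p ⊗ f x) ∼ p ⊗ ∑ xs f
⊗-distribˡ-∑ p []       f = ∼-sym (zeroʳ p)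
⊗-distribˡ-∑ p (x ∷ xs) f =
  ∼-trans (+-congˡ (⊗-distribˡ-∑ p xs f)) (∼-sym (distribˡ p (f x) (∑ xs f)))

∑-map : ∀ (e : B → A) xs f → ∑ (map e xs) f ≡ ∑ xs (f ∘ e)
∑-map e []       f = refl
∑-map e (x ∷ xs) f = cong (f (e x) ⊕_) (∑-map e xs f)

∑-concatMap : ∀ (e : B → List A) xs f → ∑ (concatMap e xs) f ∼ ∑[ x ∈ xs ] ∑ (e x) f
∑-concatMap e []       f = ∼-refl
∑-concatMap e (x ∷ xs) f = ∼-trans (∑-++ (e x) _ f) (+-congˡ (∑-concatMap e xs f))

∑-product : ∀ (e : B → C → A) xs ys f u v →
  (∀ {x y} → x ∈ xs → y ∈ ys → f (e x y) ∼ u x ⊗ v y) →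
  ∑ (cartesianProductWith e xs ys) f ∼ ∑ xs u ⊗ ∑ ys v
∑-product e []       ys f u v eq = ∼-sym (zeroˡ (∑ ys v))
∑-product e (x ∷ xs) ys f u v eq = begin
  ∑ (map (e x) ys ++ cartesianProductWith e xs ys) f
    ≈⟨ ∑-++ (map (e x) ys) _ f ⟩
  ∑ (map (e x) ys) f ⊕ ∑ (cartesianProductWith e xs ys) f
    ≈⟨ +-cong (reflexive (∑-map (e x) ys f)) (∑-product e xs ys f u v (eq ∘ there)) ⟩
  ∑ ys (f ∘ e x) ⊕ ∑ xs u ⊗ ∑ ys v
    ≈⟨ +-congʳ (∑-cong ys (eq (here refl))) ⟩
  ∑ ys (λ y → u x ⊗ v y) ⊕ ∑ xs u ⊗ ∑ ys v
    ≈⟨ +-congʳ (⊗-distribˡ-∑ (u x) ys v) ⟩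
  u x ⊗ ∑ ys v ⊕ ∑ xs u ⊗ ∑ ys v
    ≈⟨ distribʳ (∑ ys v) (u x) (∑ xs u) ⟨
  (u x ⊕ ∑ xs u) ⊗ ∑ ys v ∎

∑-splits : ∀ S (f g : Fun) → ∑[ p ∈ splits S ] f (proj₁ p) ⊗ g (proj₂ p) ∼ (f ⋆ g) S
∑-splits []      f g = +-identityʳ _
∑-splits (x ∷ S) f g = begin
  ∑ (map (map₁ (x ∷_)) (splits S) ++ map (map₂ (x ∷_)) (splits S)) F
    ≈⟨ ∑-++ (map (map₁ (x ∷_)) (splits S)) _ F ⟩
  ∑ (map (map₁ (x ∷_)) (splits S)) F ⊕ ∑ (map (map₂ (x ∷_)) (splits S)) F
    ≈⟨ +-cong (reflexive (∑-map _ (splits S) F)) (reflexive (∑-map _ (splits S) F)) ⟩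
  ∑ (splits S) (F ∘ map₁ (x ∷_)) ⊕ ∑ (splits S) (F ∘ map₂ (x ∷_))
    ≈⟨ +-cong (∑-splits S (x ▹ f) g) (∑-splits S f (x ▹ g)) ⟩
  ((x ▹ f) ⋆ g) S ⊕ (f ⋆ (x ▹ g)) S ∎
  where
  F : List ℕ × List ℕ → Poly
  F p = f (proj₁ p) ⊗ g (proj₂ p)

-- Hook weights by recursion on the tree.

factor : ℕ → ℕ → Poly
factor i s = X (i ∸ 1) ⊗ const (s ∸ 1) ⊕ const 2

-- The hook product taken along the tree instead of along `[1⋯ n ]`. In this form it is
-- multiplicative over the children and visibly invariant under `_≃_`.
weight : Tree → Poly
weight (leaf a)    = const 1
weight (one a t)   = factor a (size (one a t)) ⊗ weight t
weight (two a t u) = factor a (size (two a t u)) ⊗ (weight t ⊗ weight u)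

weight-≃ : ∀ {T U} → T ≃ U → weight T ∼ weight U
weight-≃ leaf = ∼-refl
weight-≃ E@(one {a} e) =
  *-cong (reflexive (cong (factor a) (↭-length (≃-labels E)))) (weight-≃ e)
weight-≃ E@(two {a} e e′) =
  *-cong (reflexive (cong (factor a) (↭-length (≃-labels E)))) (*-cong (weight-≃ e) (weight-≃ e′))
weight-≃ E@(swap {a} {t} {t′} {u} {u′} e e′) =
  *-cong (reflexive (cong (factor a) (↭-length (≃-labels E))))
    (∼-trans (*-cong (weight-≃ e) (weight-≃ e′)) (⊗-comm (weight u′) (weight t′)))

0<size : ∀ T → 0 < size T
0<size (leaf _)    = s≤s z≤n
0<size (one _ _)   = s≤s z≤n
0<size (two _ _ _) = s≤s z≤n

h-root : ∀ T → h (label T) T ≡ size T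
h-root T@(leaf a)    = cong (if_then size T else 0) (dec-true (a ≟ a) refl)
h-root T@(one a t)   = cong (if_then size T else h a t) (dec-true (a ≟ a) refl)
h-root T@(two a t u) = cong (if_then size T else h a t + h a u) (dec-true (a ≟ a) refl)

h-one : ∀ {i a} t → i ≢ a → h i (one a t) ≡ h i t
h-one {i} {a} t i≢a = cong (if_then size (one a t) else h i t) (dec-false (i ≟ a) i≢a)

h-two : ∀ {i a} t u → i ≢ a → h i (two a t u) ≡ h i t + h i u
h-two {i} {a} t u i≢a = cong (if_then size (two a t u) else h i t + h i u) (dec-false (i ≟ a) i≢a)

h-∉ : ∀ {i} T → i ∉ labels T → h i T ≡ 0
h-∉ {i} (leaf a)    i∉ = cong (if_then 1 else 0) (dec-false (i ≟ a) (i∉ ∘ here))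
h-∉ {i} (one a t)   i∉ = trans (h-one t (i∉ ∘ here)) (h-∉ t (i∉ ∘ there))
h-∉ {i} (two a t u) i∉ = trans (h-two t u (i∉ ∘ here))
  (cong₂ _+_ (h-∉ t (i∉ ∘ there ∘ ∈-++⁺ˡ)) (h-∉ u (i∉ ∘ there ∘ ∈-++⁺ʳ (labels t))))

-- Giving the leaves the factor 1 replaces the filtered product by one over all labels, which can be
-- reordered to follow `labels T`.
hookFactor : ℕ → ℕ → Poly
hookFactor i s = if does (1 <? s) then factor i s else const 1

hookFactor-internal : ∀ i {s} → 1 < s → hookFactor i s ≡ factor i s
hookFactor-internal i {s} 1<s = cong (if_then factor i s else const 1) (dec-true (1 <? s) 1<s)

-- Labels are distinct, so a label in one child has hook 0 in the other and never equals the root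
-- label; the product then splits along the children.
∏-hooks : ∀ T → AllPairs _≢_ (labels T) → ∏[ i ∈ labels T ] hookFactor i (h i T) ∼ weight T
∏-hooks T@(leaf a) _ = ∼-trans (*-identityʳ _) (reflexive (cong (hookFactor a) (h-root T)))
∏-hooks T@(one a t) (a∉ ∷ t!) = *-cong
  (reflexive (trans (cong (hookFactor a) (h-root T)) (hookFactor-internal a (s≤s (0<size t)))))
  (∼-trans
    (∏-cong (labels t) λ {i} i∈ →
      reflexive (cong (hookFactor i) (h-one t λ i≡a → All.lookup a∉ i∈ (sym i≡a))))
    (∏-hooks t t!))
∏-hooks T@(two a t u) (a∉ ∷ tu!) = *-cong
  (reflexive (trans (cong (hookFactor a) (h-root T)) (hookFactor-internal a (s≤s (≤-trans (0<size t)
    (subst (size t ≤_) (sym (length-++ (labels t))) (m≤m+n _ _)))))))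
  (∼-trans (∏-++ (labels t) (labels u) _) (*-cong
    (∼-trans
      (∏-cong (labels t) λ {i} i∈ → reflexive (cong (hookFactor i) (trans
        (h-two t u λ i≡a → All.lookup a∉ (∈-++⁺ˡ i∈) (sym i≡a))
        (trans (cong (λ m → h i t + m) (h-∉ u λ i∈u → disjoint i∈ i∈u)) (ℕ.+-identityʳ _)))))
      (∏-hooks t (proj₁ (++⁻ (labels t) tu!))))
    (∼-trans
      (∏-cong (labels u) λ {i} i∈ → reflexive (cong (hookFactor i) (trans
        (h-two t u λ i≡a → All.lookup a∉ (∈-++⁺ʳ (labels t) i∈) (sym i≡a))
        (cong (_+ h i u) (h-∉ t λ i∈t → disjoint i∈t i∈)))))
      (∏-hooks u (proj₁ (proj₂ (++⁻ (labels t) tu!)))))))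
  where
  disjoint : ∀ {i} → i ∈ labels t → ¬ i ∈ labels u
  disjoint i∈t i∈u = proj₂ (proj₂ (++⁻ (labels t) tu!)) i∈t i∈u refl

wt∼weight : ∀ n {T} → 𝒜 n T → wt n T ∼ weight T
wt∼weight n {T} (p , _) = begin
  wt n T                                     ≈⟨ ∏-filter (λ i → 1 <? h i T) [1⋯ n ] _ ⟩
  ∏[ i ∈ [1⋯ n ] ] hookFactor i (h i T)      ≈⟨ ∏-↭ _ p ⟨
  ∏[ i ∈ labels T ] hookFactor i (h i T)     ≈⟨ ∏-hooks T labels! ⟩
  weight T ∎
  where
  labels! : AllPairs _≢_ (labels T)
  labels! = SetoidPermutationₚ.Unique-resp-↭ (≡.setoid ℕ) (↭⇒↭ₛ (↭-sym p))
    (AllPairs.applyUpTo⁺₁ suc n λ i<j _ eq → ℕ.<⇒≢ i<j (ℕ.suc-injective eq))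

-- Summing the weights, and the product formula.

-- The root factor depends only on the total size, hence is the same for all splits and can be
-- pulled out. An absent second child contributes `G 1 [] = 1`, while for nonempty `C` the value
-- `G 1 C` is `J 1 C`.
grafts-sum : ∀ k x y S {B C} → (B , C) ∈ splits S →
  ∑ (build k (y ∷ B)) weight ∼ J 1 (y ∷ B) →
  (∀ {c C′} → C ≡ c ∷ C′ → ∑ (build k C) weight ∼ J 1 C) →
  ∑ (grafts k x y (B , C)) weight ∼ factor x (2 + length S) ⊗ (J 1 (y ∷ B) ⊗ G 1 C)
grafts-sum k x y S {B} {[]} i eq _ = begin
  ∑ (map (one x) ts) weight       ≈⟨ reflexive (∑-map (one x) ts weight) ⟩
  ∑ ts (weight ∘ one x)           ≈⟨ ∑-cong ts (λ {t} t∈ → ⊗-congʳ (weight t)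
    (reflexive (cong (λ m → factor x (suc m)) (trans (↭-length (build-labels k (y ∷ B) t∈))
      (cong suc (trans (↭-length (↭-sym (++-comm B []))) (↭-length (splits-↭ S i)))))))) ⟩
  ∑ ts (λ t → φ ⊗ weight t)       ≈⟨ ⊗-distribˡ-∑ φ ts weight ⟩
  φ ⊗ ∑ ts weight                 ≈⟨ ⊗-congˡ φ eq ⟩
  φ ⊗ J 1 (y ∷ B)                 ≈⟨ ⊗-congˡ φ (*-identityʳ (J 1 (y ∷ B))) ⟨
  φ ⊗ (J 1 (y ∷ B) ⊗ const 1) ∎
  where
  φ = factor x (2 + length S)
  ts = build k (y ∷ B)
grafts-sum k x y S {B} {C@(_ ∷ _)} i eq eq′ = begin
  ∑ (cartesianProductWith (two x) ts us) weight
    ≈⟨ ∑-product (two x) ts us weight (λ t → φ ⊗ weight t) weight (λ {t} {u} t∈ u∈ → ∼-trans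
         (⊗-congʳ (weight t ⊗ weight u) (reflexive (cong (λ m → factor x (suc m))
           (trans (↭-length (++⁺ (build-labels k (y ∷ B) t∈) (build-labels k C u∈)))
             (cong suc (↭-length (splits-↭ S i)))))))
         (∼-sym (*-assoc φ (weight t) (weight u)))) ⟩
  ∑ ts (λ t → φ ⊗ weight t) ⊗ ∑ us weight
    ≈⟨ *-cong (⊗-distribˡ-∑ φ ts weight) ∼-refl ⟩
  φ ⊗ ∑ ts weight ⊗ ∑ us weight   ≈⟨ *-assoc φ (∑ ts weight) (∑ us weight) ⟩
  φ ⊗ (∑ ts weight ⊗ ∑ us weight)
    ≈⟨ ⊗-congˡ φ (*-cong eq (∼-trans (eq′ refl) (∼-sym (+-identityʳ (J 1 C))))) ⟩
  φ ⊗ (J 1 (y ∷ B) ⊗ G 1 C) ∎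
  where
  φ = factor x (2 + length S)
  ts = build k (y ∷ B)
  us = build k C

const∼· : ∀ n → const n ∼ n · const 1
const∼· n = ∼-trans (∼-sym (*-identityʳ (const n))) (const-⊗ n (const 1))

J-singleton : ∀ a x → J a (x ∷ []) ∼ const 1
J-singleton a x = ∼-trans (+-cong (∼-refl {const 1}) (zeroʳ (X (x ∸ 1)))) (+-identityʳ (const 1))

-- Removing the root turns the sum into a convolution: `y ▹ J 1` accounts for the child with the
-- second largest label, `G 1` for the possibly absent other one.
build-sum : ∀ k x S → length S ≤ k → ∑ (build k (x ∷ S)) weight ∼ J 1 (x ∷ S)
build-sum k       x []      _       = ∼-trans (+-identityʳ (const 1)) (∼-sym (J-singleton 1 x))
build-sum (suc k) x (y ∷ S) (s≤s l) = begin
  ∑ (concatMap (grafts k x y) (splits S)) weight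
    ≈⟨ ∑-concatMap (grafts k x y) (splits S) weight ⟩
  ∑[ p ∈ splits S ] ∑ (grafts k x y p) weight
    ≈⟨ ∑-cong (splits S) (λ {p} i → grafts-sum k x y S i
         (build-sum k y (proj₁ p) (≤-trans (m≤m+n _ _) (l′ i)))
         (λ { {c} {C} refl → build-sum k c C
                (≤-trans (n≤1+n _) (≤-trans (m≤n+m _ (length (proj₁ p))) (l′ i))) })) ⟩
  ∑[ p ∈ splits S ] φ ⊗ (J 1 (y ∷ proj₁ p) ⊗ G 1 (proj₂ p))
    ≈⟨ ⊗-distribˡ-∑ φ (splits S) _ ⟩
  φ ⊗ (∑[ p ∈ splits S ] J 1 (y ∷ proj₁ p) ⊗ G 1 (proj₂ p))
    ≈⟨ ⊗-congˡ φ (∑-splits S (y ▹ J 1) (G 1)) ⟩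
  φ ⊗ ((y ▹ J 1) ⋆ G 1) S
    ≈⟨ ⊗-congˡ φ (rooted y 1 1 S) ⟩
  φ ⊗ J 2 (y ∷ S)
    -- The root factor has hook minus one equal to `n` and constant 2, exactly the factor that leads
    -- from `J 2` back to `J 1` in `J-∷∷`.
    ≈⟨ ⊗-congʳ (J 2 (y ∷ S)) (+-cong
         (∼-trans (⊗-comm (X (x ∸ 1)) (const n)) (const-⊗ n (X (x ∸ 1)))) (const∼· 2)) ⟩
  (n · X (x ∸ 1) ⊕ 2 · const 1) ⊗ J 2 (y ∷ S)
    ≈⟨ J-∷∷ x y S 1 ⟨
  J 1 (x ∷ y ∷ S) ∎
  where
  n = suc (length S)
  φ = factor x (suc n)
  l′ : ∀ {B C} → (B , C) ∈ splits S → length B + length C ≤ k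
  l′ {B} i = subst (_≤ k) (trans (sym (↭-length (splits-↭ S i))) (length-++ B)) l

-- Peeling off the largest label lowers `n` and raises `a`, so their sum in the constants is
-- preserved; this forces the general `a`. Label 1 gives no factor, and label `i + 1` gives the one
-- with `X i`.
J-downFrom : ∀ n a →
  J a (applyDownFrom suc (suc n)) ∼ ∏[ i ∈ [1⋯ n ] ] (const i ⊗ X i ⊕ const (suc n + a ∸ i))
J-downFrom zero    a = J-singleton a 1
J-downFrom (suc n) a = begin
  J a (suc (suc n) ∷ suc n ∷ S)
    ≈⟨ J-∷∷ (suc (suc n)) (suc n) S a ⟩
  (suc (length S) · X (suc n) ⊕ suc a · const 1) ⊗ J (suc a) (suc n ∷ S)
    ≈⟨ *-cong (+-cong (∼-trans (·-cong (cong suc (length-applyDownFrom suc n)) ∼-refl)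
                (∼-sym (const-⊗ (suc n) (X (suc n))))) (∼-sym (const∼· (suc a))))
         (J-downFrom n (suc a)) ⟩
  (const (suc n) ⊗ X (suc n) ⊕ const (suc a)) ⊗ ∏ [1⋯ n ] (F (suc n + suc a))
    ≈⟨ ⊗-comm (const (suc n) ⊗ X (suc n) ⊕ const (suc a)) (∏ [1⋯ n ] (F (suc n + suc a))) ⟩
  ∏ [1⋯ n ] (F (suc n + suc a)) ⊗ (const (suc n) ⊗ X (suc n) ⊕ const (suc a))
    ≈⟨ *-cong (reflexive (cong (λ k → ∏ [1⋯ n ] (F k)) (ℕ.+-suc (suc n) a)))
         (∼-trans (reflexive (cong (λ k → const (suc n) ⊗ X (suc n) ⊕ const k) (sym last)))
           (∼-sym (*-identityʳ (F N (suc n))))) ⟩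
  ∏ [1⋯ n ] (F N) ⊗ ∏ [ suc n ] (F N)
    ≈⟨ ∏-++ [1⋯ n ] [ suc n ] (F N) ⟨
  ∏ ([1⋯ n ] ++ [ suc n ]) (F N)
    ≈⟨ reflexive (cong (λ xs → ∏ xs (F N)) (applyUpTo-∷ʳ suc n)) ⟩
  ∏ [1⋯ suc n ] (F N) ∎
  where
  S = applyDownFrom suc n
  N = suc (suc n) + a
  F : ℕ → ℕ → Poly
  F k i = const i ⊗ X i ⊕ const (k ∸ i)
  last : N ∸ suc n ≡ suc a
  last = trans (cong (_∸ n) (sym (ℕ.+-suc n a))) (ℕ.m+n∸m≡n n (suc a))

-- From the generated list to an arbitrary enumeration.

downFrom↭ : ∀ n → applyDownFrom suc n ↭ [1⋯ n ]
downFrom↭ n = subst (_↭ [1⋯ n ]) (reverse-applyUpTo suc n) (↭-reverse [1⋯ n ])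

build-enumerates : ∀ n → build n (applyDownFrom suc (suc n)) Enumerates 𝒜 (suc n)
build-enumerates n = record
  { sound    = All.tabulate λ i → ↭-trans (build-labels n S i) (downFrom↭ (suc n)) ,
                                  build-decreasing n S S↘ i
  ; complete = λ (p , d) → build-complete n S S↘ (≤-reflexive (length-applyDownFrom suc (suc n)))
                  (↭-trans p (↭-sym (downFrom↭ (suc n)))) d
  ; distinct = build-distinct n S S↘
  }
  where
  S = applyDownFrom suc (suc n)
  S↘ : Descending S
  S↘ = AllPairs.applyDownFrom⁺₁ suc (suc n) λ j<i _ → s≤s j<i

-- Soundness of one list and completeness of the other show that both meet the same classes, each of
-- them once.
enumerations-↭ : ∀ {ts us P} → ts Enumerates P → us Enumerates P →
  SetoidPermutation._↭_ (DecSetoid.setoid ≃-decSetoid) ts us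
enumerations-↭ {P = P} e e′ = unique∧sameElements⇒↭ (DecSetoid.setoid ≃-decSetoid)
  (e .distinct) (e′ .distinct) (transfer e e′) (transfer e′ e)
  where
  open _Enumerates_
  transfer : ∀ {ts us} → ts Enumerates P → us Enumerates P →
    ∀ {T} → Any (T ≃_) ts → Any (T ≃_) us
  transfer e e′ i with t , t∈ , T≃t ← find i =
    Any.map (≃-trans T≃t) (e′ .complete (All.lookup (e .sound) t∈))

theorem15 :
    (n : ℕ) → n ≥ 1 → (ts : List Tree) → ts Enumerates 𝒜 n →
    ∑[ T ∈ ts ] wt n T ≈ ∏[ i ∈ [1⋯ n ∸ 1 ] ] (const i ⊗ X i ⊕ const (n + 1 ∸ i))
theorem15 n@(suc m) _ ts e = ∼⇒≈ (begin
  ∑[ T ∈ ts ] wt n T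
    ≈⟨ ∑-cong ts (λ T∈ → wt∼weight n (All.lookup (_Enumerates_.sound e) T∈)) ⟩
  ∑ ts weight
    -- As `weight` respects `_≃_`, the sum is the same for every choice of representatives and may
    -- be taken over the generated list.
    ≈⟨ ∑-↭ (SetoidPermutationₚ.map⁺ (DecSetoid.setoid ≃-decSetoid) setoid weight-≃
         (enumerations-↭ e (build-enumerates m))) ⟩
  ∑ (build m (applyDownFrom suc n)) weight
    ≈⟨ build-sum m n (applyDownFrom suc m) (≤-reflexive (length-applyDownFrom suc m)) ⟩
  J 1 (applyDownFrom suc n)
    ≈⟨ J-downFrom m 1 ⟩
  ∏[ i ∈ [1⋯ m ] ] (const i ⊗ X i ⊕ const (n + 1 ∸ i)) ∎)
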